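{- $\mathsf{Cospan}^{\leq}(\mathbb F)\cong\mathbb{CB}^{\leq}_{\emptyset}$ as preordered cartesian bicategories.
   Context: $\mathbb F$ is the category whose objects are the finite ordinals $n=\{0,\dots,n-1\}$ and whose arrows are all functions. $\mathsf{Cospan}^{\leq}(\mathbb F)$ has the finite ordinals as objects, arrows $n\to m$ the isomorphism classes of cospans $n\to A\leftarrow m$ in $\mathbb F$, composition by pushout, monoidal product by coproduct (sum of ordinals), and preorder $(n\to A\leftarrow m)\le(n\to B\leftarrow m)$ iff there is a function $B\to A$ commuting with the legs. Its monoid on $X$ is $X+X\xrightarrow{[\mathrm{id},\mathrm{id}]}X\xleftarrow{\mathrm{id}}X$ and $0\to X\xleftarrow{\mathrm{id}}X$, its comonoid the reversed cospans. A preordered cartesian bicategory is a symmetric monoidal category $(\mathcal B,\oplus,I)$ with preordered hom-sets (composition, $\oplus$ monotone), each object $X$ carrying a monoid $\mu_X:X\oplus X\to X,\eta_X:I\to X$ and comonoid $\delta_X:X\to X\oplus X,\varepsilon_X:X\to I$ forming a special commutative Frobenius bimonoid (diagrammatic order $;$: $(\delta_X\oplus\mathrm{id});(\mathrm{id}\oplus\mu_X)=\mu_X;\delta_X=(\mathrm{id}\oplus\delta_X);(\mu_X\oplus\mathrm{id})$, $\delta_X;\mu_X=\mathrm{id}_X$, plus (co)associativity, (co)unit and (co)commutativity), with $\mathrm{id}_X\le\varepsilon_X;\eta_X$, $\eta_X;\varepsilon_X\le\mathrm{id}_I$, $\mathrm{id}_X\le\delta_X;\mu_X$, $\mu_X;\delta_X\le\mathrm{id}_{X\oplus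 X}$, and every arrow $R:X\to Y$ satisfying $R;\delta_Y\le\delta_X;(R\oplus R)$, $R;\varepsilon_Y\le\varepsilon_X$. Morphisms: monoidal functors preserving preorders, monoids and comonoids. $\mathbb{CB}^{\leq}_{\emptyset}$: terms generated by constants $\delta:(1,2)$, $\varepsilon:(1,0)$, $\mu:(2,1)$, $\eta:(0,1)$, $\mathrm{id}_0:(0,0)$, $\mathrm{id}_1:(1,1)$, $\sigma:(2,2)$, sequential composition $c;d$ (sorts $(n,z),(z,m)\mapsto(n,m)$) and $c\oplus d$ (sorts $(n,m),(p,q)\mapsto(n+p,m+q)$). Arrows $n\to m$ are terms of sort $(n,m)$ modulo the smallest congruence generated by: strict symmetric monoidal category laws with symmetry generated by $\sigma$; $\delta;(\delta\oplus\mathrm{id}_1)=\delta;(\mathrm{id}_1\oplus\delta)$, $\delta;(\varepsilon\oplus\mathrm{id}_1)=\mathrm{id}_1$, $\delta;\sigma=\delta$; $(\mu\oplus\mathrm{id}_1);\mu=(\mathrm{id}_1\oplus\mu);\mu$, $(\eta\oplus\mathrm{id}_1);\mu=\mathrm{id}_1$, $\sigma;\mu=\mu$; $(\delta\oplus\mathrm{id}_1);(\mathrm{id}_1\oplus\mu)=\mu;\delta=(\mathrm{id}_1\oplus\delta);(\mu\oplus\mathrm{id}_1)$; $\delta;\mu=\mathrm{id}_1$. They are ordered by the smallest precongruence (preorder compatible with $;$ and $\oplus$) generated by $\mathrm{id}_1\le\varepsilon;\eta$, $\eta;\varepsilon\le\mathrm{id}_0$, $\mathrm{id}_1\le\delta;\mu$,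 $\mu;\delta\le\mathrm{id}_2$. -}

module Defs where

open import Data.Nat using (ℕ; zero; suc; _+_)
open import Data.Nat.Properties using (+-assoc; +-identityʳ)
open import Data.Fin using (Fin; zero; suc; _↑ˡ_; _↑ʳ_; splitAt)
open import Data.Sum using ([_,_])
open import Data.Product using (Σ; ∃; _×_; _,_)
open import Function.Bundles using (_↔_; Inverse)
open import Relation.Binary.PropositionalEquality using (_≡_; refl; sym; subst₂)

infixl 5 _⨾_
infixl 6 _⊕_

data Term : ℕ → ℕ → Set where
  δ   : Term 1 2
  ε   : Term 1 0
  μ   : Term 2 1
  η   : Term 0 1
  id₀ : Term 0 0
  id₁ : Term 1 1
  σ   : Term 2 2
  _⨾_ : ∀ {n z m} → Term n z → Term z m → Term n m
  _⊕_ : ∀ {n m p q} → Term n m → Term p q → Term (n + p) (m + q)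

cast : ∀ {n n' m m'} → n ≡ n' → m ≡ m' → Term n m → Term n' m'
cast = subst₂ Term

idn : ∀ n → Term n n
idn zero    = id₀
idn (suc n) = id₁ ⊕ idn n

σ₁ : ∀ m → Term (1 + m) (m + 1)
σ₁ zero    = id₁
σ₁ (suc m) = (σ ⊕ idn m) ⨾ (id₁ ⊕ σ₁ m)

σn : ∀ n m → Term (n + m) (m + n)
σn zero    m = cast refl (sym (+-identityʳ m)) (idn m)
σn (suc n) m = (id₁ ⊕ σn n m) ⨾ cast refl (+-assoc m 1 n) (σ₁ m ⊕ idn n)

infix 4 _≈_ _≤_

data _≈_ : ∀ {n m} → Term n m → Term n m → Set where
  ≈-refl  : ∀ {n m} {c : Term n m} → c ≈ c
  ≈-sym   : ∀ {n m} {c d : Term n m} → c ≈ d → d ≈ c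
  ≈-trans : ∀ {n m} {c d e : Term n m} → c ≈ d → d ≈ e → c ≈ e
  ⨾-cong  : ∀ {n z m} {c c' : Term n z} {d d' : Term z m} →
            c ≈ c' → d ≈ d' → c ⨾ d ≈ c' ⨾ d'
  ⊕-cong  : ∀ {n m p q} {c c' : Term n m} {d d' : Term p q} →
            c ≈ c' → d ≈ d' → c ⊕ d ≈ c' ⊕ d'
  ⨾-assoc : ∀ {n z w m} (c : Term n z) (d : Term z w) (e : Term w m) →
            (c ⨾ d) ⨾ e ≈ c ⨾ (d ⨾ e)
  ⨾-idˡ   : ∀ {n m} (c : Term n m) → idn n ⨾ c ≈ c
  ⨾-idʳ   : ∀ {n m} (c : Term n m) → c ⨾ idn m ≈ c
  ⊕-assoc : ∀ {n m p q r s} (c : Term n m) (d : Term p q) (e : Term r s) →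
            cast (+-assoc n p r) (+-assoc m q s) ((c ⊕ d) ⊕ e) ≈ c ⊕ (d ⊕ e)
  ⊕-unitˡ : ∀ {n m} (c : Term n m) → id₀ ⊕ c ≈ c
  ⊕-unitʳ : ∀ {n m} (c : Term n m) →
            cast (+-identityʳ n) (+-identityʳ m) (c ⊕ id₀) ≈ c
  ⊕-id    : ∀ n m → idn n ⊕ idn m ≈ idn (n + m)
  interchange : ∀ {n z m p w q} (c : Term n z) (d : Term z m)
                (c' : Term p w) (d' : Term w q) →
                (c ⨾ d) ⊕ (c' ⨾ d') ≈ (c ⊕ c') ⨾ (d ⊕ d')
  σ-gen   : σn 1 1 ≈ σ
  σ-nat   : ∀ {n m p q} (c : Term n m) (d : Term p q) →
            (c ⊕ d) ⨾ σn m q ≈ σn n p ⨾ (d ⊕ c)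
  σ-inv   : ∀ n m → σn n m ⨾ σn m n ≈ idn (n + m)
  σ-hex₁  : ∀ n m p →
            σn (n + m) p ≈
            cast (sym (+-assoc n m p)) (+-assoc p n m)
              ((idn n ⊕ σn m p) ⨾ cast (+-assoc n p m) refl (σn n p ⊕ idn m))
  σ-hex₂  : ∀ n m p →
            σn n (m + p) ≈
            cast (+-assoc n m p) (sym (+-assoc m p n))
              (cast refl (+-assoc m n p) (σn n m ⊕ idn p) ⨾ (idn m ⊕ σn n p))
  δ-assoc : δ ⨾ (δ ⊕ id₁) ≈ δ ⨾ (id₁ ⊕ δ)
  δ-unit  : δ ⨾ (ε ⊕ id₁) ≈ id₁
  δ-comm  : δ ⨾ σ ≈ δ
  μ-assoc : (μ ⊕ id₁) ⨾ μ ≈ (id₁ ⊕ μ) ⨾ μ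
  μ-unit  : (η ⊕ id₁) ⨾ μ ≈ id₁
  μ-comm  : σ ⨾ μ ≈ μ
  frob₁   : (δ ⊕ id₁) ⨾ (id₁ ⊕ μ) ≈ μ ⨾ δ
  frob₂   : μ ⨾ δ ≈ (id₁ ⊕ δ) ⨾ (μ ⊕ id₁)
  special : δ ⨾ μ ≈ id₁

data _≤_ : ∀ {n m} → Term n m → Term n m → Set where
  ≤-≈     : ∀ {n m} {c d : Term n m} → c ≈ d → c ≤ d
  ≤-trans : ∀ {n m} {c d e : Term n m} → c ≤ d → d ≤ e → c ≤ e
  ⨾-mono  : ∀ {n z m} {c c' : Term n z} {d d' : Term z m} →
            c ≤ c' → d ≤ d' → c ⨾ d ≤ c' ⨾ d'
  ⊕-mono  : ∀ {n m p q} {c c' : Term n m} {d d' : Term p q} →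
            c ≤ c' → d ≤ d' → c ⊕ d ≤ c' ⊕ d'
  ax₁ : id₁ ≤ ε ⨾ η
  ax₂ : η ⨾ ε ≤ id₀
  ax₃ : id₁ ≤ δ ⨾ μ
  ax₄ : μ ⨾ δ ≤ idn 2

record Cospan (n m : ℕ) : Set where
  constructor cospan
  field
    apex  : ℕ
    left  : Fin n → Fin apex
    right : Fin m → Fin apex
open Cospan public

infix 4 _≅_ _⊑_

-- isomorphism of cospans (equality of arrows of Cospan^≤(F))
record _≅_ {n m} (c d : Cospan n m) : Set where
  field
    iso   : Fin (apex c) ↔ Fin (apex d)
    commˡ : ∀ i → Inverse.to iso (left c i) ≡ left d i
    commʳ : ∀ j → Inverse.to iso (right c j) ≡ right d j

_⊑_ : ∀ {n m} → Cospan n m → Cospan n m → Set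
c ⊑ d = Σ (Fin (apex d) → Fin (apex c)) λ g →
          (∀ i → g (left d i) ≡ left c i) × (∀ j → g (right d j) ≡ right c j)

record IsComposite {n z m} (c : Cospan n z) (d : Cospan z m)
                   (e : Cospan n m) : Set where
  field
    inl    : Fin (apex c) → Fin (apex e)
    inr    : Fin (apex d) → Fin (apex e)
    square : ∀ k → inl (right c k) ≡ inr (left d k)
    legˡ   : ∀ i → left e i ≡ inl (left c i)
    legʳ   : ∀ j → right e j ≡ inr (right d j)
    universal : ∀ q (a : Fin (apex c) → Fin q) (b : Fin (apex d) → Fin q) →
                (∀ k → a (right c k) ≡ b (left d k)) →
                Σ (Fin (apex e) → Fin q) λ h →
                  (∀ x → h (inl x) ≡ a x) × (∀ y → h (inr y) ≡ b y) ×
                  (∀ (h' : Fin (apex e) → Fin q) →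
                     (∀ x → h' (inl x) ≡ a x) → (∀ y → h' (inr y) ≡ b y) →
                     ∀ w → h' w ≡ h w)

_+F_ : ∀ {n p A B} → (Fin n → Fin A) → (Fin p → Fin B) → Fin (n + p) → Fin (A + B)
_+F_ {n} {p} {A} {B} f g x = [ (λ i → f i ↑ˡ B) , (λ j → A ↑ʳ g j) ] (splitAt n x)

_⊕C_ : ∀ {n m p q} → Cospan n m → Cospan p q → Cospan (n + p) (m + q)
c ⊕C d = cospan (apex c + apex d) (left c +F left d) (right c +F right d)

idC : ∀ n → Cospan n n
idC n = cospan n (λ i → i) (λ i → i)

swap₂ : Fin 2 → Fin 2
swap₂ zero       = suc zero
swap₂ (suc zero) = zero

σC : Cospan 2 2
σC = cospan 2 (λ i → i) swap₂

μC : Cospan 2 1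
μC = cospan 1 (λ _ → zero) (λ i → i)

ηC : Cospan 0 1
ηC = cospan 1 (λ ()) (λ i → i)

δC : Cospan 1 2
δC = cospan 1 (λ i → i) (λ _ → zero)

εC : Cospan 1 0
εC = cospan 1 (λ i → i) (λ ())

record IsCBIso (F : ∀ {n m} → Term n m → Cospan n m) : Set where
  field
    F-resp-≈ : ∀ {n m} {t u : Term n m} → t ≈ u → F t ≅ F u
    F-mono   : ∀ {n m} {t u : Term n m} → t ≤ u → F t ⊑ F u
    F-⨾  : ∀ {n z m} (t : Term n z) (u : Term z m) →
           IsComposite (F t) (F u) (F (t ⨾ u))
    F-⊕  : ∀ {n m p q} (t : Term n m) (u : Term p q) →
           F (t ⊕ u) ≅ F t ⊕C F u
    F-id₀ : F id₀ ≅ idC 0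
    F-id₁ : F id₁ ≅ idC 1
    F-σ   : F σ ≅ σC
    F-μ : F μ ≅ μC
    F-η : F η ≅ ηC
    F-δ : F δ ≅ δC
    F-ε : F ε ≅ εC
    F-inj  : ∀ {n m} {t u : Term n m} → F t ≅ F u → t ≈ u
    F-surj : ∀ {n m} (c : Cospan n m) → ∃ λ (t : Term n m) → F t ≅ c
    F-refl : ∀ {n m} {t u : Term n m} → F t ⊑ F u → t ≤ u

{-# OPTIONS --safe #-}

-- The functor F evaluates a term by computing pushouts of finite sets.
--
-- Soundness.  A colouring of t assigns one of q colours to every wire of t.  Equal terms have
-- naturally isomorphic families of colourings, smaller terms map into larger ones, and the
-- colourings of t are the functions on the apex of F t; so the Yoneda lemma turns these
-- transformations into maps of cospans.
--
-- Completeness.  A function f : n → A denotes a term [f], built by letting the input wires run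
-- one at a time into the wires of A, and n → A ← m denotes [l] ; [r]°, where ° reverses terms.
-- This assignment respects ⊕, and it respects composition by the Beck–Chevalley law
-- [f]° ; [g] = [inl] ; [inr]° for pushout squares, proved along a recursive construction of the
-- pushout that glues one pair of points at a time.  Hence every t equals the normal form of F t.
-- The order is reflected because [g] ; [g]° ≤ id for every function g.

module Submission where

open import Defs
open import Axiom.UniquenessOfIdentityProofs using (module Decidable⇒UIP)
open import Data.Nat using (ℕ; zero; suc; _+_)
open import Data.Nat.Properties using (+-assoc; +-identityʳ; suc-injective)
open import Data.Fin using (Fin; zero; suc; _≟_; _↑ˡ_; _↑ʳ_; splitAt; punchIn) renaming (lift to liftF)
open import Data.Fin.Permutation using (Permutation; _⟨$⟩ʳ_; remove; punchIn-permute)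
open import Data.Fin.Properties using (splitAt-↑ˡ; splitAt-↑ʳ; join-splitAt)
open import Data.List using (List; []; _∷_; _++_; length; map; take; drop; replicate; tabulate)
open import Data.List.Properties
  using (≡-dec; ++-assoc; ++-identityʳ; map-++; length-++; ∷-injectiveˡ; ∷-injectiveʳ; tabulate-cong; take++drop≡id)
open import Data.Product using (Σ; ∃; _,_; _×_; proj₁; proj₂)
open import Data.Sum as Sum using (_⊎_; [_,_]; inj₁; inj₂)
open import Data.Unit using (⊤; tt)
open import Function using (_∘_; id; const)
open import Function.Bundles using (Inverse; mk↔ₛ′)
open import Function.Construct.Identity using (↔-id)
open import Relation.Binary.Bundles using (Setoid)
open import Relation.Binary.Construct.Closure.ReflexiveTransitive using (Star; gmap)
  renaming (ε to []; _◅_ to infixr 4.5 _◅_; _◅◅_ to infixr 4.5 _◅◅_)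
open import Relation.Binary.PropositionalEquality as ≡
  using (_≡_; refl; sym; trans; cong; cong₂; _≗_; module ≡-Reasoning)
import Relation.Binary.Reasoning.Setoid as SetoidReasoning

-- Checking the axioms directly on cospans would mean comparing iterated pushouts whose apexes are
-- differently computed numbers. On colourings, composition is a fibre product over the shared
-- boundary: associativity rebrackets tuples, the symmetry laws become identities between list
-- rotations, and the Frobenius laws hold because both sides are connected. Isomorphisms of
-- colourings have to be natural in the colours, whereas an inequality is read off at a single
-- colouring, the one that gives each point of the apex its own colour.
--
-- Completeness meets another obstacle: `⊕` is associative and unital only up to casts. Rewriting is
-- therefore arranged so that a generator sits on the first wires, with single `id₁`s before it and
-- `idn n` after it; at such literal arities the casts compute away, and Beck-Chevalley reduces to
-- statements about one additional wire.
--
-- Surjectivity uses representability a second time: `c` itself represents the colourings of its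
-- normal form, hence is isomorphic to the cospan that `F` computes from it.

private variable
  a b c d n m p q r s z : ℕ

-- Colourings of terms

-- Boundaries are lists instead of vectors, so that casts of terms leave them unchanged.
Col : Term n m → ℕ → Set
src : (t : Term n m) → Col t q → List (Fin q)
tgt : (t : Term n m) → Col t q → List (Fin q)

Col δ q = Fin q
Col ε q = Fin q
Col μ q = Fin q
Col η q = Fin q
Col id₀ q = ⊤
Col id₁ q = Fin q
Col σ q = Fin q × Fin q
Col (t ⨾ u) q = Σ (Col t q × Col u q) λ a → tgt t (proj₁ a) ≡ src u (proj₂ a)
Col (t ⊕ u) q = Col t q × Col u q

src δ x = x ∷ []
src ε x = x ∷ []
src μ x = x ∷ x ∷ []
src η x = []
src id₀ _ = []
src id₁ x = x ∷ []
src σ (x , y) = x ∷ y ∷ []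
src (t ⨾ u) ((a , b) , _) = src t a
src (t ⊕ u) (a , b) = src t a ++ src u b

tgt δ x = x ∷ x ∷ []
tgt ε x = []
tgt μ x = x ∷ []
tgt η x = x ∷ []
tgt id₀ _ = []
tgt id₁ x = x ∷ []
tgt σ (x , y) = y ∷ x ∷ []
tgt (t ⨾ u) ((a , b) , _) = tgt u b
tgt (t ⊕ u) (a , b) = tgt t a ++ tgt u b

-- Functoriality in the colours. The boundary equations are proved simultaneously because
-- recolouring a composite has to transport its matching proof.
recolour : (t : Term n m) → (Fin q → Fin r) → Col t q → Col t r
src-recolour : (t : Term n m) (f : Fin q → Fin r) (a : Col t q) → src t (recolour t f a) ≡ map f (src t a)
tgt-recolour : (t : Term n m) (f : Fin q → Fin r) (a : Col t q) → tgt t (recolour t f a) ≡ map f (tgt t a)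

recolour δ f x = f x
recolour ε f x = f x
recolour μ f x = f x
recolour η f x = f x
recolour id₀ f x = tt
recolour id₁ f x = f x
recolour σ f (x , y) = f x , f y
recolour (t ⨾ u) f ((a , b) , e) = (recolour t f a , recolour u f b) ,
  trans (tgt-recolour t f a) (trans (cong (map f) e) (sym (src-recolour u f b)))
recolour (t ⊕ u) f (a , b) = recolour t f a , recolour u f b

src-recolour δ f x = refl
src-recolour ε f x = refl
src-recolour μ f x = refl
src-recolour η f x = refl
src-recolour id₀ f x = refl
src-recolour id₁ f x = refl
src-recolour σ f x = refl
src-recolour (t ⨾ u) f ((a , b) , e) = src-recolour t f a
src-recolour (t ⊕ u) f (a , b) = trans (cong₂ _++_ (src-recolour t f a) (src-recolour u f b)) (sym (map-++ f (src t a) (src u b)))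

tgt-recolour δ f x = refl
tgt-recolour ε f x = refl
tgt-recolour μ f x = refl
tgt-recolour η f x = refl
tgt-recolour id₀ f x = refl
tgt-recolour id₁ f x = refl
tgt-recolour σ f x = refl
tgt-recolour (t ⨾ u) f ((a , b) , e) = tgt-recolour u f b
tgt-recolour (t ⊕ u) f (a , b) = trans (cong₂ _++_ (tgt-recolour t f a) (tgt-recolour u f b)) (sym (map-++ f (tgt t a) (tgt u b)))

-- Recovers the arity that list boundaries forget; it decides where a concatenation of boundaries is
-- cut.
length-src : (t : Term n m) (a : Col t q) → length (src t a) ≡ n
length-src δ x = refl
length-src ε x = refl
length-src μ x = refl
length-src η x = refl
length-src id₀ x = refl
length-src id₁ x = refl
length-src σ x = refl
length-src (t ⨾ u) ((a , b) , e) = length-src t a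
length-src (t ⊕ u) (a , b) = trans (length-++ (src t a)) (cong₂ _+_ (length-src t a) (length-src u b))

length-tgt : (t : Term n m) (a : Col t q) → length (tgt t a) ≡ m
length-tgt δ x = refl
length-tgt ε x = refl
length-tgt μ x = refl
length-tgt η x = refl
length-tgt id₀ x = refl
length-tgt id₁ x = refl
length-tgt σ x = refl
length-tgt (t ⨾ u) ((a , b) , e) = length-tgt u b
length-tgt (t ⊕ u) (a , b) = trans (length-++ (tgt t a)) (cong₂ _+_ (length-tgt t a) (length-tgt u b))

-- Lists over `Fin q` have decidable equality, so matching proofs are unique and only the underlying
-- pair of colourings counts.
Σ≡ : {A : Set} {xs ys : A → List (Fin q)} {x y : Σ A λ a → xs a ≡ ys a} → proj₁ x ≡ proj₁ y → x ≡ y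
Σ≡ {x = a , e} {.a , e′} refl = cong (a ,_) (Decidable⇒UIP.≡-irrelevant (≡-dec _≟_) e e′)

++-injective : {A : Set} (as as′ : List A) {bs bs′ : List A} →
               length as ≡ length as′ → as ++ bs ≡ as′ ++ bs′ → as ≡ as′ × bs ≡ bs′
++-injective [] [] _ e = refl , e
++-injective (x ∷ as) (y ∷ as′) l e with ++-injective as as′ (suc-injective l) (∷-injectiveʳ e)
... | as≡ , bs≡ = cong₂ _∷_ (∷-injectiveˡ e) as≡ , bs≡

-- Natural isomorphisms of colourings

infix 4 _≃_
-- The two terms may have different sorts, so that a term can be compared with its casts. Naturality
-- is demanded of `to`; that of `from` follows in `≃-sym`.
record _≃_ (t : Term n m) (u : Term p r) : Set where
  field
    to      : ∀ {q} → Col t q → Col u q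
    from    : ∀ {q} → Col u q → Col t q
    from-to : ∀ {q} (a : Col t q) → from (to a) ≡ a
    to-from : ∀ {q} (b : Col u q) → to (from b) ≡ b
    src-to  : ∀ {q} (a : Col t q) → src u (to a) ≡ src t a
    tgt-to  : ∀ {q} (a : Col t q) → tgt u (to a) ≡ tgt t a
    natural : ∀ {q s} (f : Fin q → Fin s) (a : Col t q) → to (recolour t f a) ≡ recolour u f (to a)

≃-refl : {t : Term n m} → t ≃ t
≃-refl = record
  { to = id ; from = id ; from-to = λ _ → refl ; to-from = λ _ → refl
  ; src-to = λ _ → refl ; tgt-to = λ _ → refl ; natural = λ _ _ → refl }

≃-sym : {t : Term n m} {u : Term p r} → t ≃ u → u ≃ t
≃-sym {t = t} {u} t≃u = record
  { to = from ; from = to ; from-to = to-from ; to-from = from-to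
  ; src-to = λ b → trans (sym (src-to (from b))) (cong (src u) (to-from b))
  ; tgt-to = λ b → trans (sym (tgt-to (from b))) (cong (tgt u) (to-from b))
  ; natural = λ f b → trans (cong (from ∘ recolour u f) (sym (to-from b)))
                        (trans (cong from (sym (natural f (from b)))) (from-to _)) }
  where open _≃_ t≃u

≃-trans : {t : Term n m} {u : Term p r} {v : Term a b} → t ≃ u → u ≃ v → t ≃ v
≃-trans t≃u u≃v = record
  { to = V.to ∘ U.to ; from = U.from ∘ V.from
  ; from-to = λ a → trans (cong U.from (V.from-to (U.to a))) (U.from-to a)
  ; to-from = λ b → trans (cong V.to (U.to-from (V.from b))) (V.to-from b)
  ; src-to = λ a → trans (V.src-to (U.to a)) (U.src-to a)
  ; tgt-to = λ a → trans (V.tgt-to (U.to a)) (U.tgt-to a)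
  ; natural = λ f a → trans (cong V.to (U.natural f a)) (V.natural f (U.to a)) }
  where
  module U = _≃_ t≃u
  module V = _≃_ u≃v

≃-⨾ : {t t′ : Term n m} {u u′ : Term m p} → t ≃ t′ → u ≃ u′ → t ⨾ u ≃ t′ ⨾ u′
≃-⨾ {t = t} {t′} {u} {u′} t≃t′ u≃u′ = record
  { to = λ { ((a , b) , e) → (T.to a , U.to b) , trans (T.tgt-to a) (trans e (sym (U.src-to b))) }
  ; from = λ { ((a , b) , e) → (T.from a , U.from b) , trans (T⁻¹.tgt-to a) (trans e (sym (U⁻¹.src-to b))) }
  ; from-to = λ { ((a , b) , e) → Σ≡ (cong₂ _,_ (T.from-to a) (U.from-to b)) }
  ; to-from = λ { ((a , b) , e) → Σ≡ (cong₂ _,_ (T.to-from a) (U.to-from b)) }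
  ; src-to = λ { ((a , b) , e) → T.src-to a }
  ; tgt-to = λ { ((a , b) , e) → U.tgt-to b }
  ; natural = λ { f ((a , b) , e) → Σ≡ (cong₂ _,_ (T.natural f a) (U.natural f b)) } }
  where
  module T = _≃_ t≃t′
  module U = _≃_ u≃u′
  module T⁻¹ = _≃_ (≃-sym t≃t′)
  module U⁻¹ = _≃_ (≃-sym u≃u′)

≃-⊕ : {t t′ : Term n m} {u u′ : Term p r} → t ≃ t′ → u ≃ u′ → t ⊕ u ≃ t′ ⊕ u′
≃-⊕ t≃t′ u≃u′ = record
  { to = λ { (a , b) → T.to a , U.to b }
  ; from = λ { (a , b) → T.from a , U.from b }
  ; from-to = λ { (a , b) → cong₂ _,_ (T.from-to a) (U.from-to b) }
  ; to-from = λ { (a , b) → cong₂ _,_ (T.to-from a) (U.to-from b) }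
  ; src-to = λ { (a , b) → cong₂ _++_ (T.src-to a) (U.src-to b) }
  ; tgt-to = λ { (a , b) → cong₂ _++_ (T.tgt-to a) (U.tgt-to b) }
  ; natural = λ { f (a , b) → cong₂ _,_ (T.natural f a) (U.natural f b) } }
  where
  module T = _≃_ t≃t′
  module U = _≃_ u≃u′

≃-cast : (e : n ≡ a) (e′ : m ≡ b) (t : Term n m) → cast e e′ t ≃ t
≃-cast refl refl t = ≃-refl

≃-⨾-assoc : (t : Term n z) (u : Term z p) (v : Term p m) → (t ⨾ u) ⨾ v ≃ t ⨾ (u ⨾ v)
≃-⨾-assoc t u v = record
  { to = λ { ((((a , b) , e) , c) , e′) → (a , ((b , c) , e′)) , e }
  ; from = λ { ((a , ((b , c) , e′)) , e) → (((a , b) , e) , c) , e′ }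
  ; from-to = λ _ → refl ; to-from = λ _ → refl ; src-to = λ _ → refl ; tgt-to = λ _ → refl
  ; natural = λ f x → refl }

≃-⊕-assoc : (t : Term n m) (u : Term p r) (v : Term a b) → (t ⊕ u) ⊕ v ≃ t ⊕ (u ⊕ v)
≃-⊕-assoc t u v = record
  { to = λ { ((a , b) , c) → a , (b , c) }
  ; from = λ { (a , (b , c)) → (a , b) , c }
  ; from-to = λ _ → refl ; to-from = λ _ → refl
  ; src-to = λ { ((a , b) , c) → sym (++-assoc (src t a) (src u b) (src v c)) }
  ; tgt-to = λ { ((a , b) , c) → sym (++-assoc (tgt t a) (tgt u b) (tgt v c)) }
  ; natural = λ f x → refl }

≃-⊕-unitˡ : (t : Term n m) → id₀ ⊕ t ≃ t
≃-⊕-unitˡ t = record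
  { to = proj₂ ; from = tt ,_
  ; from-to = λ _ → refl ; to-from = λ _ → refl ; src-to = λ _ → refl ; tgt-to = λ _ → refl
  ; natural = λ f x → refl }

≃-⊕-unitʳ : (t : Term n m) → t ⊕ id₀ ≃ t
≃-⊕-unitʳ t = record
  { to = proj₁ ; from = _, tt
  ; from-to = λ _ → refl ; to-from = λ _ → refl
  ; src-to = λ { (a , _) → sym (++-identityʳ (src t a)) }
  ; tgt-to = λ { (a , _) → sym (++-identityʳ (tgt t a)) }
  ; natural = λ f x → refl }

-- A matching of the concatenated boundaries splits into two matchings because `tgt t a` and
-- `src u b` have the same length.
≃-interchange : (t : Term n z) (u : Term z m) (t′ : Term p a) (u′ : Term a r) →
                (t ⨾ u) ⊕ (t′ ⨾ u′) ≃ (t ⊕ t′) ⨾ (u ⊕ u′)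
≃-interchange t u t′ u′ = record
  { to = λ { (((a , b) , e) , ((a′ , b′) , e′)) → ((a , a′) , (b , b′)) , cong₂ _++_ e e′ }
  ; from = λ { (((a , a′) , (b , b′)) , e) →
      let e₁ , e₂ = ++-injective (tgt t a) (src u b) (trans (length-tgt t a) (sym (length-src u b))) e
      in ((a , b) , e₁) , ((a′ , b′) , e₂) }
  ; from-to = λ _ → cong₂ _,_ (Σ≡ refl) (Σ≡ refl)
  ; to-from = λ _ → Σ≡ refl
  ; src-to = λ _ → refl ; tgt-to = λ _ → refl
  ; natural = λ f x → Σ≡ refl }

-- Terms whose colourings are determined by the source

Rewiring : Set
Rewiring = ∀ {q} → List (Fin q) → List (Fin q)

-- Colourings correspond under `src` to lists of length `n`, and `ρ` computes the target from the
-- source. Two wirings with the same `ρ` are then isomorphic, which turns the coherence laws of the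
-- symmetry into list identities.
record Wiring (t : Term n m) (ρ : Rewiring) : Set where
  field
    fill          : ∀ {q} (xs : List (Fin q)) → length xs ≡ n → Col t q
    src-fill      : ∀ {q} (xs : List (Fin q)) (l : length xs ≡ n) → src t (fill xs l) ≡ xs
    src-injective : ∀ {q} {a b : Col t q} → src t a ≡ src t b → a ≡ b
    tgt-src       : ∀ {q} (a : Col t q) → tgt t a ≡ ρ (src t a)

  recolour-fill : ∀ {q s} (f : Fin q → Fin s) {xs : List (Fin q)} (l : length xs ≡ n) {ys : List (Fin s)} (l′ : length ys ≡ n) →
                  ys ≡ map f xs → fill ys l′ ≡ recolour t f (fill xs l)
  recolour-fill f l l′ e = src-injective (trans (src-fill _ l′)
    (trans e (sym (trans (src-recolour t f _) (cong (map f) (src-fill _ l))))))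

  tgt-fill : ∀ {q} (xs : List (Fin q)) (l : length xs ≡ n) → tgt t (fill xs l) ≡ ρ xs
  tgt-fill xs l = trans (tgt-src _) (cong ρ (src-fill xs l))

  fill-unique : ∀ {q} {xs : List (Fin q)} (l : length xs ≡ n) {a : Col t q} → xs ≡ src t a → fill xs l ≡ a
  fill-unique l e = src-injective (trans (src-fill _ l) e)

wiring-resp : {t : Term n m} {ρ ρ′ : Rewiring} → Wiring t ρ →
              (∀ {q} (xs : List (Fin q)) → length xs ≡ n → ρ xs ≡ ρ′ xs) → Wiring t ρ′
wiring-resp {t = t} W ρ≗ρ′ = record
  { fill = fill ; src-fill = src-fill ; src-injective = src-injective
  ; tgt-src = λ a → trans (tgt-src a) (ρ≗ρ′ (src t a) (length-src t a)) }
  where open Wiring W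

wiring-≃ : {t u : Term n m} {ρ ρ′ : Rewiring} → Wiring t ρ → Wiring u ρ′ →
           (∀ {q} (xs : List (Fin q)) → length xs ≡ n → ρ xs ≡ ρ′ xs) → t ≃ u
wiring-≃ {t = t} {u} {ρ} {ρ′} Wt Wu ρ≗ρ′ = record
  { to = λ a → U.fill (src t a) (length-src t a)
  ; from = λ b → T.fill (src u b) (length-src u b)
  ; from-to = λ a → T.fill-unique _ (U.src-fill _ _)
  ; to-from = λ b → U.fill-unique _ (T.src-fill _ _)
  ; src-to = λ a → U.src-fill _ _
  ; tgt-to = λ a → trans (U.tgt-fill _ (length-src t a)) (trans (sym (ρ≗ρ′ (src t a) (length-src t a))) (sym (T.tgt-src a)))
  ; natural = λ f a → U.recolour-fill f _ _ (src-recolour t f a) }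
  where
  module T = Wiring Wt
  module U = Wiring Wu

wiring-cast : (e : n ≡ a) (e′ : m ≡ b) (t : Term n m) {ρ : Rewiring} → Wiring t ρ → Wiring (cast e e′ t) ρ
wiring-cast refl refl t W = W

wiring-⨾ : (t : Term n m) (u : Term m p) {ρ ρ′ : Rewiring} → Wiring t ρ → Wiring u ρ′ → Wiring (t ⨾ u) (ρ′ ∘ ρ)
wiring-⨾ t u {ρ} {ρ′} Wt Wu = record
  { fill = λ xs l → let a = T.fill xs l in (a , U.fill (tgt t a) (length-tgt t a)) , sym (U.src-fill _ _)
  ; src-fill = T.src-fill
  ; src-injective = λ { {a = (a , b) , e} {(a′ , b′) , e′} sa≡sa′ →
      let a≡a′ = T.src-injective sa≡sa′ in
      Σ≡ (cong₂ _,_ a≡a′ (U.src-injective (trans (sym e) (trans (cong (tgt t) a≡a′) e′)))) }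
  ; tgt-src = λ { ((a , b) , e) → trans (U.tgt-src b) (cong ρ′ (trans (sym e) (T.tgt-src a))) } }
  where
  module T = Wiring Wt
  module U = Wiring Wu

-- Cutting and rotating lists

record Splitting {A : Set} (n m : ℕ) (xs : List A) : Set where
  constructor splitting
  field
    front back   : List A
    front++back  : front ++ back ≡ xs
    length-front : length front ≡ n
    length-back  : length back ≡ m

splitList : {A : Set} (n : ℕ) {m : ℕ} (xs : List A) → length xs ≡ n + m → Splitting n m xs
splitList zero xs l = splitting [] xs refl refl l
splitList (suc n) (x ∷ xs) l with splitList n xs (suc-injective l)
... | splitting as bs e lf lb = splitting (x ∷ as) bs (cong (x ∷_) e) (cong suc lf) lb

take-++ : {A : Set} (as bs : List A) → length as ≡ n → take n (as ++ bs) ≡ as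
take-++ [] bs refl = refl
take-++ (x ∷ as) bs refl = cong (x ∷_) (take-++ as bs refl)

drop-++ : {A : Set} (as bs : List A) → length as ≡ n → drop n (as ++ bs) ≡ bs
drop-++ [] bs refl = refl
drop-++ (x ∷ as) bs refl = drop-++ as bs refl

par : ℕ → Rewiring → Rewiring → Rewiring
par n ρ ρ′ xs = ρ (take n xs) ++ ρ′ (drop n xs)

rot : ℕ → Rewiring
rot n xs = drop n xs ++ take n xs

module _ {q} (as bs : List (Fin q)) (l : length as ≡ n) where
  par-++ : (ρ ρ′ : Rewiring) → par n ρ ρ′ (as ++ bs) ≡ ρ as ++ ρ′ bs
  par-++ ρ ρ′ = cong₂ (λ xs ys → ρ xs ++ ρ′ ys) (take-++ as bs l) (drop-++ as bs l)

  rot-++ : rot n (as ++ bs) ≡ bs ++ as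
  rot-++ = cong₂ _++_ (drop-++ as bs l) (take-++ as bs l)

wiring-⊕ : (t : Term n m) (u : Term p r) {ρ ρ′ : Rewiring} → Wiring t ρ → Wiring u ρ′ → Wiring (t ⊕ u) (par n ρ ρ′)
wiring-⊕ {n} t u {ρ} {ρ′} Wt Wu = record
  { fill = λ xs l → let open Splitting (splitList n xs l) in T.fill front length-front , U.fill back length-back
  ; src-fill = λ xs l → let open Splitting (splitList n xs l) in
      trans (cong₂ _++_ (T.src-fill front length-front) (U.src-fill back length-back)) front++back
  ; src-injective = λ { {a = a , b} {a′ , b′} e →
      let e₁ , e₂ = ++-injective (src t a) (src t a′) (trans (length-src t a) (sym (length-src t a′))) e
      in cong₂ _,_ (T.src-injective e₁) (U.src-injective e₂) }
  ; tgt-src = λ { (a , b) → trans (cong₂ _++_ (T.tgt-src a) (U.tgt-src b))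
      (sym (par-++ (src t a) (src u b) (length-src t a) ρ ρ′)) } }
  where
  module T = Wiring Wt
  module U = Wiring Wu

wiring-id₀ : Wiring id₀ id
wiring-id₀ = record
  { fill = λ _ _ → tt ; src-fill = λ { [] _ → refl } ; src-injective = λ _ → refl ; tgt-src = λ _ → refl }

wiring-id₁ : Wiring id₁ id
wiring-id₁ = record
  { fill = λ { (x ∷ []) _ → x } ; src-fill = λ { (x ∷ []) _ → refl }
  ; src-injective = ∷-injectiveˡ ; tgt-src = λ _ → refl }

wiring-σ : Wiring σ (rot 1)
wiring-σ = record
  { fill = λ { (x ∷ y ∷ []) _ → x , y } ; src-fill = λ { (x ∷ y ∷ []) _ → refl }
  ; src-injective = λ e → cong₂ _,_ (∷-injectiveˡ e) (∷-injectiveˡ (∷-injectiveʳ e)) ; tgt-src = λ _ → refl }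

wiring-idn : ∀ n → Wiring (idn n) id
wiring-idn zero = wiring-id₀
wiring-idn (suc n) = wiring-resp (wiring-⊕ id₁ (idn n) wiring-id₁ (wiring-idn n)) λ { (x ∷ xs) _ → refl }

wiring-σ₁ : ∀ m → Wiring (σ₁ m) (rot 1)
wiring-σ₁ zero = wiring-resp wiring-id₁ λ { (x ∷ []) _ → refl }
wiring-σ₁ (suc m) = wiring-resp
  (wiring-⨾ _ _ (wiring-⊕ σ (idn m) wiring-σ (wiring-idn m)) (wiring-⊕ id₁ (σ₁ m) wiring-id₁ (wiring-σ₁ m)))
  λ { (x ∷ y ∷ xs) _ → refl }

-- The recursion first takes `x ∷ as ++ bs` to `x ∷ bs ++ as` and then moves `x` behind `bs`.
wiring-σn : ∀ n m → Wiring (σn n m) (rot n)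
wiring-σn zero m = wiring-resp (wiring-cast refl (sym (+-identityʳ m)) (idn m) (wiring-idn m))
  λ xs _ → sym (++-identityʳ xs)
wiring-σn (suc n) m = wiring-resp
  (wiring-⨾ _ _ (wiring-⊕ id₁ (σn n m) wiring-id₁ (wiring-σn n m))
    (wiring-cast refl (+-assoc m 1 n) _ (wiring-⊕ (σ₁ m) (idn n) (wiring-σ₁ m) (wiring-idn n))))
  rewire
  where
  rewire : ∀ {q} (xs : List (Fin q)) → length xs ≡ suc n + m → par (1 + m) (rot 1) id (par 1 id (rot n) xs) ≡ rot (suc n) xs
  rewire (x ∷ xs) l with splitList n xs (suc-injective l)
  ... | splitting as bs refl la lb = begin
    par (1 + m) (rot 1) id (x ∷ rot n (as ++ bs))
      ≡⟨ cong (par (1 + m) (rot 1) id ∘ (x ∷_)) (rot-++ as bs la) ⟩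
    par (1 + m) (rot 1) id ((x ∷ bs) ++ as)        ≡⟨ par-++ (x ∷ bs) as (cong suc lb) (rot 1) id ⟩
    (bs ++ x ∷ []) ++ as                           ≡⟨ ++-assoc bs _ as ⟩
    bs ++ x ∷ as                                   ≡⟨ rot-++ (x ∷ as) bs (cong suc la) ⟨
    rot (suc n) (x ∷ as ++ bs)                     ∎
    where open ≡-Reasoning

≃-⨾-idˡ : (t : Term n m) → idn n ⨾ t ≃ t
≃-⨾-idˡ {n} t = record
  { to = λ { ((v , a) , e) → a }
  ; from = λ a → (fill (src t a) (length-src t a) , a) , tgt-fill _ _
  ; from-to = λ { ((v , a) , e) → Σ≡ (cong (_, a) (fill-unique _ (trans (sym e) (tgt-src v)))) }
  ; to-from = λ _ → refl
  ; src-to = λ { ((v , a) , e) → trans (sym e) (tgt-src v) }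
  ; tgt-to = λ _ → refl ; natural = λ _ _ → refl }
  where open Wiring (wiring-idn n)

≃-⨾-idʳ : (t : Term n m) → t ⨾ idn m ≃ t
≃-⨾-idʳ {m = m} t = record
  { to = λ { ((a , v) , e) → a }
  ; from = λ a → (a , fill (tgt t a) (length-tgt t a)) , sym (src-fill _ _)
  ; from-to = λ { ((a , v) , e) → Σ≡ (cong (a ,_) (fill-unique _ e)) }
  ; to-from = λ _ → refl ; src-to = λ _ → refl
  ; tgt-to = λ { ((a , v) , e) → trans e (sym (tgt-src v)) }
  ; natural = λ _ _ → refl }
  where open Wiring (wiring-idn m)

≃-σ-nat : (t : Term n m) (u : Term p r) → (t ⊕ u) ⨾ σn m r ≃ σn n p ⨾ (u ⊕ t)
≃-σ-nat {n} {m} {p} {r} t u = record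
  { to = λ { (((a , b) , w) , e) → (S.fill _ (length-src (t ⊕ u) (a , b)) , (b , a)) ,
             trans (S.tgt-fill _ _) (rot-++ (src t a) (src u b) (length-src t a)) }
  ; from = λ { ((w , (b , a)) , e) → ((a , b) , T.fill _ (length-tgt (t ⊕ u) (a , b))) , sym (T.src-fill _ _) }
  ; from-to = λ { (((a , b) , w) , e) → Σ≡ (cong ((a , b) ,_) (T.fill-unique _ e)) }
  ; to-from = λ { ((w , (b , a)) , e) → Σ≡ (cong (_, (b , a)) (S.fill-unique _ (unrotate w a b e))) }
  ; src-to = λ { (((a , b) , w) , e) → S.src-fill _ _ }
  ; tgt-to = λ { (((a , b) , w) , e) → sym (trans (T.tgt-src w) (trans (cong (rot m) (sym e)) (rot-++ (tgt t a) (tgt u b) (length-tgt t a)))) }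
  ; natural = λ { f (((a , b) , w) , e) → Σ≡ (cong (_, (recolour u f b , recolour t f a)) (S.recolour-fill f _ _ (src-recolour (t ⊕ u) f (a , b)))) } }
  where
  module S = Wiring (wiring-σn n p)
  module T = Wiring (wiring-σn m r)
  -- In this direction only the target of the symmetry is known to match. Cutting its source at `n`
  -- and comparing the rotated halves recovers the source.
  unrotate : ∀ {q} (w : Col (σn n p) q) (a : Col t q) (b : Col u q) → tgt (σn n p) w ≡ src u b ++ src t a →
             src t a ++ src u b ≡ src (σn n p) w
  unrotate w a b e with splitList n (src (σn n p) w) (length-src (σn n p) w)
  ... | splitting xs ys eq lx ly
      with ++-injective ys (src u b) (trans ly (sym (length-src u b)))
             (trans (sym (rot-++ xs ys lx)) (trans (cong (rot n) eq) (trans (sym (S.tgt-src w)) e)))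
  ...    | refl , refl = eq

≃-σ-inv : ∀ n m → σn n m ⨾ σn m n ≃ idn (n + m)
≃-σ-inv n m = wiring-≃ (wiring-⨾ _ _ (wiring-σn n m) (wiring-σn m n)) (wiring-idn (n + m)) rewire
  where
  rewire : ∀ {q} (xs : List (Fin q)) → length xs ≡ n + m → rot m (rot n xs) ≡ xs
  rewire xs l with splitList n xs l
  ... | splitting as bs refl la lb = trans (cong (rot m) (rot-++ as bs la)) (rot-++ bs as lb)

-- Both sides are wirings that carry `as ++ bs ++ cs` to `cs ++ as ++ bs`; the right-hand side moves
-- `bs` past `cs` and then `as`.
≃-σ-hex₁ : ∀ n m p → σn (n + m) p ≃ cast (sym (+-assoc n m p)) (+-assoc p n m)
             ((idn n ⊕ σn m p) ⨾ cast (+-assoc n p m) refl (σn n p ⊕ idn m))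
≃-σ-hex₁ n m p = wiring-≃ (wiring-σn (n + m) p)
  (wiring-cast (sym (+-assoc n m p)) (+-assoc p n m) _
    (wiring-⨾ _ _ (wiring-⊕ _ _ (wiring-idn n) (wiring-σn m p))
      (wiring-cast (+-assoc n p m) refl _ (wiring-⊕ _ _ (wiring-σn n p) (wiring-idn m)))))
  rewire
  where
  rewire : ∀ {q} (xs : List (Fin q)) → length xs ≡ n + m + p → rot (n + m) xs ≡ par (n + p) (rot n) id (par n id (rot m) xs)
  rewire xs l with splitList n xs (trans l (+-assoc n m p))
  ... | splitting as ys refl la ly with splitList m ys ly
  ... | splitting bs cs refl lb lc = begin
    rot (n + m) (as ++ bs ++ cs)
      ≡⟨ cong (rot (n + m)) (++-assoc as bs cs) ⟨
    rot (n + m) ((as ++ bs) ++ cs)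
      ≡⟨ rot-++ (as ++ bs) cs (trans (length-++ as) (cong₂ _+_ la lb)) ⟩
    cs ++ as ++ bs                                                   ≡⟨ ++-assoc cs as bs ⟨
    (cs ++ as) ++ bs                                                 ≡⟨ cong (_++ bs) (rot-++ as cs la) ⟨
    rot n (as ++ cs) ++ bs
      ≡⟨ par-++ (as ++ cs) bs (trans (length-++ as) (cong₂ _+_ la lc)) (rot n) id ⟨
    par (n + p) (rot n) id ((as ++ cs) ++ bs)
      ≡⟨ cong (par (n + p) (rot n) id) (++-assoc as cs bs) ⟩
    par (n + p) (rot n) id (as ++ cs ++ bs)
      ≡⟨ cong (λ zs → par (n + p) (rot n) id (as ++ zs)) (rot-++ bs cs lb) ⟨
    par (n + p) (rot n) id (as ++ rot m (bs ++ cs))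
      ≡⟨ cong (par (n + p) (rot n) id) (par-++ as (bs ++ cs) la id (rot m)) ⟨
    par (n + p) (rot n) id (par n id (rot m) (as ++ bs ++ cs))       ∎
    where open ≡-Reasoning

≃-σ-hex₂ : ∀ n m p → σn n (m + p) ≃ cast (+-assoc n m p) (sym (+-assoc m p n))
             (cast refl (+-assoc m n p) (σn n m ⊕ idn p) ⨾ (idn m ⊕ σn n p))
≃-σ-hex₂ n m p = wiring-≃ (wiring-σn n (m + p))
  (wiring-cast (+-assoc n m p) (sym (+-assoc m p n)) _
    (wiring-⨾ _ _ (wiring-cast refl (+-assoc m n p) _ (wiring-⊕ _ _ (wiring-σn n m) (wiring-idn p)))
      (wiring-⊕ _ _ (wiring-idn m) (wiring-σn n p))))
  rewire
  where
  rewire : ∀ {q} (xs : List (Fin q)) → length xs ≡ n + (m + p) → rot n xs ≡ par m id (rot n) (par (n + m) (rot n) id xs)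
  rewire xs l with splitList n xs l
  ... | splitting as ys refl la ly with splitList m ys ly
  ... | splitting bs cs refl lb lc = begin
    rot n (as ++ bs ++ cs)                                           ≡⟨ rot-++ as (bs ++ cs) la ⟩
    (bs ++ cs) ++ as                                                 ≡⟨ ++-assoc bs cs as ⟩
    bs ++ cs ++ as                                                   ≡⟨ cong (bs ++_) (rot-++ as cs la) ⟨
    bs ++ rot n (as ++ cs)                                           ≡⟨ par-++ bs (as ++ cs) lb id (rot n) ⟨
    par m id (rot n) (bs ++ as ++ cs)
      ≡⟨ cong (par m id (rot n)) (++-assoc bs as cs) ⟨
    par m id (rot n) ((bs ++ as) ++ cs)
      ≡⟨ cong (λ zs → par m id (rot n) (zs ++ cs)) (rot-++ as bs la) ⟨
    par m id (rot n) (rot n (as ++ bs) ++ cs)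
      ≡⟨ cong (par m id (rot n)) (par-++ (as ++ bs) cs (trans (length-++ as) (cong₂ _+_ la lb)) (rot n) id) ⟨
    par m id (rot n) (par (n + m) (rot n) id ((as ++ bs) ++ cs))
      ≡⟨ cong (par m id (rot n) ∘ par (n + m) (rot n) id) (++-assoc as bs cs) ⟩
    par m id (rot n) (par (n + m) (rot n) id (as ++ bs ++ cs))       ∎
    where open ≡-Reasoning

-- Terms whose wires all carry the same colour

-- A connected term: one colour reaches every wire, so colourings are single colours and the arities
-- determine the boundaries. Each monoid, comonoid and Frobenius axiom equates two such terms of the
-- same sort.
record Spider (t : Term n m) : Set where
  field
    fill          : ∀ {q} → Fin q → Col t q
    point         : ∀ {q} → Col t q → Fin q
    fill-point    : ∀ {q} (a : Col t q) → fill (point a) ≡ a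
    point-fill    : ∀ {q} (x : Fin q) → point (fill x) ≡ x
    src-fill      : ∀ {q} (x : Fin q) → src t (fill x) ≡ replicate n x
    tgt-fill      : ∀ {q} (x : Fin q) → tgt t (fill x) ≡ replicate m x
    point-natural : ∀ {q s} (f : Fin q → Fin s) (a : Col t q) → point (recolour t f a) ≡ f (point a)

  recolour-fill : ∀ {q s} (f : Fin q → Fin s) (x : Fin q) → recolour t f (fill x) ≡ fill (f x)
  recolour-fill f x = trans (sym (fill-point _)) (cong fill (trans (point-natural f (fill x)) (cong f (point-fill x))))

spider-≃ : {t u : Term n m} → Spider t → Spider u → t ≃ u
spider-≃ {t = t} {u} St Su = record
  { to = U.fill ∘ T.point ; from = T.fill ∘ U.point
  ; from-to = λ a → trans (cong T.fill (U.point-fill _)) (T.fill-point a)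
  ; to-from = λ b → trans (cong U.fill (T.point-fill _)) (U.fill-point b)
  ; src-to = λ a → trans (U.src-fill _) (trans (sym (T.src-fill _)) (cong (src t) (T.fill-point a)))
  ; tgt-to = λ a → trans (U.tgt-fill _) (trans (sym (T.tgt-fill _)) (cong (tgt t) (T.fill-point a)))
  ; natural = λ f a → trans (cong U.fill (T.point-natural f a)) (sym (U.recolour-fill f (T.point a))) }
  where
  module T = Spider St
  module U = Spider Su

spider-δ : Spider δ
spider-δ = record
  { fill = id ; point = id ; fill-point = λ _ → refl ; point-fill = λ _ → refl
  ; src-fill = λ _ → refl ; tgt-fill = λ _ → refl ; point-natural = λ _ _ → refl }

spider-ε : Spider ε
spider-ε = record
  { fill = id ; point = id ; fill-point = λ _ → refl ; point-fill = λ _ → refl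
  ; src-fill = λ _ → refl ; tgt-fill = λ _ → refl ; point-natural = λ _ _ → refl }

spider-μ : Spider μ
spider-μ = record
  { fill = id ; point = id ; fill-point = λ _ → refl ; point-fill = λ _ → refl
  ; src-fill = λ _ → refl ; tgt-fill = λ _ → refl ; point-natural = λ _ _ → refl }

spider-η : Spider η
spider-η = record
  { fill = id ; point = id ; fill-point = λ _ → refl ; point-fill = λ _ → refl
  ; src-fill = λ _ → refl ; tgt-fill = λ _ → refl ; point-natural = λ _ _ → refl }

spider-id₁ : Spider id₁
spider-id₁ = record
  { fill = id ; point = id ; fill-point = λ _ → refl ; point-fill = λ _ → refl
  ; src-fill = λ _ → refl ; tgt-fill = λ _ → refl ; point-natural = λ _ _ → refl }

≃-δ-assoc : δ ⨾ (δ ⊕ id₁) ≃ δ ⨾ (id₁ ⊕ δ)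
≃-δ-assoc = spider-≃
  record
    { fill = λ x → (x , (x , x)) , refl ; point = proj₁ ∘ proj₁
    ; fill-point = λ { ((x , (y , z)) , refl) → refl } ; point-fill = λ _ → refl
    ; src-fill = λ _ → refl ; tgt-fill = λ _ → refl ; point-natural = λ _ _ → refl }
  record
    { fill = λ x → (x , (x , x)) , refl ; point = proj₁ ∘ proj₁
    ; fill-point = λ { ((x , (y , z)) , refl) → refl } ; point-fill = λ _ → refl
    ; src-fill = λ _ → refl ; tgt-fill = λ _ → refl ; point-natural = λ _ _ → refl }

≃-δ-unit : δ ⨾ (ε ⊕ id₁) ≃ id₁
≃-δ-unit = spider-≃
  record
    { fill = λ x → (x , (x , x)) , refl ; point = proj₁ ∘ proj₁
    ; fill-point = λ { ((x , (y , z)) , refl) → refl } ; point-fill = λ _ → refl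
    ; src-fill = λ _ → refl ; tgt-fill = λ _ → refl ; point-natural = λ _ _ → refl }
  spider-id₁

≃-δ-comm : δ ⨾ σ ≃ δ
≃-δ-comm = spider-≃
  record
    { fill = λ x → (x , (x , x)) , refl ; point = proj₁ ∘ proj₁
    ; fill-point = λ { ((x , (y , z)) , refl) → refl } ; point-fill = λ _ → refl
    ; src-fill = λ _ → refl ; tgt-fill = λ _ → refl ; point-natural = λ _ _ → refl }
  spider-δ

≃-μ-assoc : (μ ⊕ id₁) ⨾ μ ≃ (id₁ ⊕ μ) ⨾ μ
≃-μ-assoc = spider-≃
  record
    { fill = λ x → ((x , x) , x) , refl ; point = proj₂ ∘ proj₁
    ; fill-point = λ { (((x , y) , z) , refl) → refl } ; point-fill = λ _ → refl
    ; src-fill = λ _ → refl ; tgt-fill = λ _ → refl ; point-natural = λ _ _ → refl }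
  record
    { fill = λ x → ((x , x) , x) , refl ; point = proj₂ ∘ proj₁
    ; fill-point = λ { (((x , y) , z) , refl) → refl } ; point-fill = λ _ → refl
    ; src-fill = λ _ → refl ; tgt-fill = λ _ → refl ; point-natural = λ _ _ → refl }

≃-μ-unit : (η ⊕ id₁) ⨾ μ ≃ id₁
≃-μ-unit = spider-≃
  record
    { fill = λ x → ((x , x) , x) , refl ; point = proj₂ ∘ proj₁
    ; fill-point = λ { (((x , y) , z) , refl) → refl } ; point-fill = λ _ → refl
    ; src-fill = λ _ → refl ; tgt-fill = λ _ → refl ; point-natural = λ _ _ → refl }
  spider-id₁

≃-μ-comm : σ ⨾ μ ≃ μ
≃-μ-comm = spider-≃
  record
    { fill = λ x → ((x , x) , x) , refl ; point = proj₂ ∘ proj₁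
    ; fill-point = λ { (((x , y) , z) , refl) → refl } ; point-fill = λ _ → refl
    ; src-fill = λ _ → refl ; tgt-fill = λ _ → refl ; point-natural = λ _ _ → refl }
  spider-μ

spider-μ⨾δ : Spider (μ ⨾ δ)
spider-μ⨾δ = record
  { fill = λ x → (x , x) , refl ; point = proj₁ ∘ proj₁
  ; fill-point = λ { ((x , y) , refl) → refl } ; point-fill = λ _ → refl
  ; src-fill = λ _ → refl ; tgt-fill = λ _ → refl ; point-natural = λ _ _ → refl }

≃-frob₁ : (δ ⊕ id₁) ⨾ (id₁ ⊕ μ) ≃ μ ⨾ δ
≃-frob₁ = spider-≃
  record
    { fill = λ x → ((x , x) , (x , x)) , refl ; point = proj₁ ∘ proj₁ ∘ proj₁
    ; fill-point = λ { (((x , y) , (z , w)) , refl) → refl } ; point-fill = λ _ → refl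
    ; src-fill = λ _ → refl ; tgt-fill = λ _ → refl ; point-natural = λ _ _ → refl }
  spider-μ⨾δ

≃-frob₂ : μ ⨾ δ ≃ (id₁ ⊕ δ) ⨾ (μ ⊕ id₁)
≃-frob₂ = spider-≃ spider-μ⨾δ
  record
    { fill = λ x → ((x , x) , (x , x)) , refl ; point = proj₁ ∘ proj₁ ∘ proj₁
    ; fill-point = λ { (((x , y) , (z , w)) , refl) → refl } ; point-fill = λ _ → refl
    ; src-fill = λ _ → refl ; tgt-fill = λ _ → refl ; point-natural = λ _ _ → refl }

≃-special : δ ⨾ μ ≃ id₁
≃-special = spider-≃
  record
    { fill = λ x → (x , x) , refl ; point = proj₁ ∘ proj₁
    -- The boundary equation states `x ≡ y` twice; its first component identifies the colours, and
    -- uniqueness of the matching proof does the rest.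
    ; fill-point = λ { ((x , y) , e) → Σ≡ (cong (x ,_) (∷-injectiveˡ e)) } ; point-fill = λ _ → refl
    ; src-fill = λ _ → refl ; tgt-fill = λ _ → refl ; point-natural = λ _ _ → refl }
  spider-id₁

-- Soundness

≈⇒≃ : {t u : Term n m} → t ≈ u → t ≃ u
≈⇒≃ ≈-refl = ≃-refl
≈⇒≃ (≈-sym e) = ≃-sym (≈⇒≃ e)
≈⇒≃ (≈-trans e f) = ≃-trans (≈⇒≃ e) (≈⇒≃ f)
≈⇒≃ (⨾-cong e f) = ≃-⨾ (≈⇒≃ e) (≈⇒≃ f)
≈⇒≃ (⊕-cong e f) = ≃-⊕ (≈⇒≃ e) (≈⇒≃ f)
≈⇒≃ (⨾-assoc c d e) = ≃-⨾-assoc c d e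
≈⇒≃ (⨾-idˡ c) = ≃-⨾-idˡ c
≈⇒≃ (⨾-idʳ c) = ≃-⨾-idʳ c
≈⇒≃ (⊕-assoc {n} {m} {p} {q} {r} {s} c d e) =
  ≃-trans (≃-cast (+-assoc n p r) (+-assoc m q s) _) (≃-⊕-assoc c d e)
≈⇒≃ (⊕-unitˡ c) = ≃-⊕-unitˡ c
≈⇒≃ (⊕-unitʳ {n} {m} c) = ≃-trans (≃-cast (+-identityʳ n) (+-identityʳ m) _) (≃-⊕-unitʳ c)
≈⇒≃ (⊕-id n m) = wiring-≃ (wiring-⊕ _ _ (wiring-idn n) (wiring-idn m)) (wiring-idn (n + m))
  λ xs _ → take++drop≡id n xs
≈⇒≃ (interchange c d c′ d′) = ≃-interchange c d c′ d′
≈⇒≃ σ-gen = wiring-≃ (wiring-σn 1 1) wiring-σ λ _ _ → refl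
≈⇒≃ (σ-nat c d) = ≃-σ-nat c d
≈⇒≃ (σ-inv n m) = ≃-σ-inv n m
≈⇒≃ (σ-hex₁ n m p) = ≃-σ-hex₁ n m p
≈⇒≃ (σ-hex₂ n m p) = ≃-σ-hex₂ n m p
≈⇒≃ δ-assoc = ≃-δ-assoc
≈⇒≃ δ-unit = ≃-δ-unit
≈⇒≃ δ-comm = ≃-δ-comm
≈⇒≃ μ-assoc = ≃-μ-assoc
≈⇒≃ μ-unit = ≃-μ-unit
≈⇒≃ μ-comm = ≃-μ-comm
≈⇒≃ frob₁ = ≃-frob₁
≈⇒≃ frob₂ = ≃-frob₂
≈⇒≃ special = ≃-special

infix 4 _⇛_
-- Larger terms admit more colourings of the boundary: cutting a wire apart or dropping a closed
-- component removes a constraint.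
_⇛_ : Term n m → Term n m → Set
t ⇛ u = ∀ {q} (a : Col t q) → Σ (Col u q) λ b → src u b ≡ src t a × tgt u b ≡ tgt t a

≤⇒⇛ : {t u : Term n m} → t ≤ u → t ⇛ u
≤⇒⇛ (≤-≈ e) a = to a , src-to a , tgt-to a
  where open _≃_ (≈⇒≃ e)
≤⇒⇛ (≤-trans e f) a =
  let b , sb , tb = ≤⇒⇛ e a
      c , sc , tc = ≤⇒⇛ f b
  in c , trans sc sb , trans tc tb
≤⇒⇛ (⨾-mono e f) ((a , b) , ab) =
  let a′ , sa , ta = ≤⇒⇛ e a
      b′ , sb , tb = ≤⇒⇛ f b
  in ((a′ , b′) , trans ta (trans ab (sym sb))) , sa , tb
≤⇒⇛ (⊕-mono e f) (a , b) =
  let a′ , sa , ta = ≤⇒⇛ e a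
      b′ , sb , tb = ≤⇒⇛ f b
  in (a′ , b′) , cong₂ _++_ sa sb , cong₂ _++_ ta tb
≤⇒⇛ ax₁ x = ((x , x) , refl) , refl , refl
≤⇒⇛ ax₂ _ = tt , refl , refl
≤⇒⇛ ax₃ x = ((x , x) , refl) , refl , refl
-- Doubling `x ∷ [] ≡ y ∷ []` equates the two targets.
≤⇒⇛ ax₄ ((x , y) , e) = (x , (x , tt)) , refl , cong (λ zs → zs ++ zs) e

-- Colourings of a term as functions on the apex of a cospan

-- The apex of `c` represents the functor `Col t`, and the legs of `c` induce the boundaries.
-- Functions are compared pointwise, hence `paint-cong`.
record Represents (t : Term n m) (c : Cospan n m) : Set where
  field
    paint         : ∀ {q} → (Fin (apex c) → Fin q) → Col t q
    value         : ∀ {q} → Col t q → Fin (apex c) → Fin q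
    paint-cong    : ∀ {q} {h k : Fin (apex c) → Fin q} → h ≗ k → paint h ≡ paint k
    paint-value   : ∀ {q} (a : Col t q) → paint (value a) ≡ a
    value-paint   : ∀ {q} (h : Fin (apex c) → Fin q) → value (paint h) ≗ h
    src-paint     : ∀ {q} (h : Fin (apex c) → Fin q) → src t (paint h) ≡ tabulate (h ∘ left c)
    tgt-paint     : ∀ {q} (h : Fin (apex c) → Fin q) → tgt t (paint h) ≡ tabulate (h ∘ right c)
    value-natural : ∀ {q s} (f : Fin q → Fin s) (a : Col t q) → value (recolour t f a) ≗ f ∘ value a

  src-value : ∀ {q} (a : Col t q) → src t a ≡ tabulate (value a ∘ left c)
  src-value a = trans (cong (src t) (sym (paint-value a))) (src-paint (value a))

  tgt-value : ∀ {q} (a : Col t q) → tgt t a ≡ tabulate (value a ∘ right c)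
  tgt-value a = trans (cong (tgt t) (sym (paint-value a))) (tgt-paint (value a))

  value-injective : ∀ {q} {a b : Col t q} → value a ≗ value b → a ≡ b
  value-injective {a = a} {b} e = trans (sym (paint-value a)) (trans (paint-cong e) (paint-value b))

tabulate-injective : {A : Set} {f g : Fin n → A} → tabulate f ≡ tabulate g → f ≗ g
tabulate-injective e zero = ∷-injectiveˡ e
tabulate-injective e (suc i) = tabulate-injective (∷-injectiveʳ e) i

-- In the colouring `paint id` each point of `apex c` is its own colour. Its image is a colouring of
-- `u` by `apex c`, that is a map `apex d → apex c`, and equality of boundaries says that this map
-- commutes with the legs.
⇛⇒⊑ : {t u : Term n m} {c d : Cospan n m} → Represents t c → Represents u d → t ⇛ u → c ⊑ d
⇛⇒⊑ Rt Ru t⇛u =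
  let b , sb , tb = t⇛u (T.paint id) in
  U.value b ,
  tabulate-injective (trans (sym (U.src-value b)) (trans sb (T.src-paint id))) ,
  tabulate-injective (trans (sym (U.tgt-value b)) (trans tb (T.tgt-paint id)))
  where
  module T = Represents Rt
  module U = Represents Ru

module _ {t u : Term n m} {c d : Cospan n m} (Rt : Represents t c) (Ru : Represents u d) (t≃u : t ≃ u) where
  private
    module T = Represents Rt
    module U = Represents Ru
  open _≃_ t≃u

  transport : Fin (apex d) → Fin (apex c)
  transport = U.value (to (T.paint id))

  -- The Yoneda argument: recolouring the universal colouring along `value (from b)` produces
  -- `from b`, which naturality sends to `b`.
  transport-natural : (b : Col u q) → T.value (from b) ∘ transport ≗ U.value b
  transport-natural b w = begin
    f (U.value (to (T.paint id)) w)             ≡⟨ U.value-natural f (to (T.paint id)) w ⟨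
    U.value (recolour u f (to (T.paint id))) w  ≡⟨ cong (λ a → U.value a w) (natural f (T.paint id)) ⟨
    U.value (to (recolour t f (T.paint id))) w  ≡⟨ cong (λ a → U.value (to a) w) (T.value-injective same) ⟩
    U.value (to (from b)) w                     ≡⟨ cong (λ a → U.value a w) (to-from b) ⟩
    U.value b w                                 ∎
    where
    open ≡-Reasoning
    f = T.value (from b)
    same : T.value (recolour t f (T.paint id)) ≗ f
    same x = trans (T.value-natural f (T.paint id) x) (cong f (T.value-paint id x))

≃⇒≅ : {t u : Term n m} {c d : Cospan n m} → Represents t c → Represents u d → t ≃ u → c ≅ d
≃⇒≅ {t = t} {u} {c} {d} Rt Ru t≃u = record
  { iso = mk↔ₛ′ (transport Ru Rt u≃t) (transport Rt Ru t≃u)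
      -- At `b = paint id` the map `value (from b)` is the opposite transport, so naturality says
      -- that the two are inverse.
      (λ y → trans (transport-natural Rt Ru t≃u (U.paint id) y) (U.value-paint id y))
      (λ x → trans (transport-natural Ru Rt u≃t (T.paint id) x) (T.value-paint id x))
  ; commˡ = proj₁ (proj₂ d⊑c)
  ; commʳ = proj₂ (proj₂ d⊑c) }
  where
  module T = Represents Rt
  module U = Represents Ru
  u≃t = ≃-sym t≃u
  d⊑c : d ⊑ c
  d⊑c = ⇛⇒⊑ Ru Rt λ b → _≃_.to u≃t b , _≃_.src-to u≃t b , _≃_.tgt-to u≃t b

represents-resp : {t : Term n m} {c : Cospan n m} {l : Fin n → Fin (apex c)} {r : Fin m → Fin (apex c)} →
                  Represents t c → left c ≗ l → right c ≗ r → Represents t (cospan (apex c) l r)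
represents-resp R l≗ r≗ = record
  { paint = paint ; value = value ; paint-cong = paint-cong ; paint-value = paint-value ; value-paint = value-paint
  ; src-paint = λ h → trans (src-paint h) (tabulate-cong (cong h ∘ l≗))
  ; tgt-paint = λ h → trans (tgt-paint h) (tabulate-cong (cong h ∘ r≗))
  ; value-natural = value-natural }
  where open Represents R

-- A colouring of a composite is a pair of functions on the two apexes that agree on the middle
-- wires, which is a cocone; the universal property of the pushout turns it into one function.
represents-⨾ : {t : Term n z} {u : Term z m} {c : Cospan n z} {d : Cospan z m} {e : Cospan n m} →
               Represents t c → Represents u d → IsComposite c d e → Represents (t ⨾ u) e
represents-⨾ {t = t} {u} {c} {d} {e} Rt Ru comp = record
  { paint = paint
  ; value = λ a → proj₁ (glue a)
  ; paint-cong = λ h≗k → Σ≡ (cong₂ _,_ (T.paint-cong (h≗k ∘ inl)) (U.paint-cong (h≗k ∘ inr)))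
  ; paint-value = λ { x@((a , b) , _) → let _ , hl , hr , _ = glue x in
      Σ≡ (cong₂ _,_ (trans (T.paint-cong hl) (T.paint-value a)) (trans (U.paint-cong hr) (U.paint-value b))) }
  ; value-paint = λ h w → let _ , _ , _ , unique = glue (paint h) in
      sym (unique h (λ x → sym (T.value-paint (h ∘ inl) x)) (λ y → sym (U.value-paint (h ∘ inr) y)) w)
  ; src-paint = λ h → trans (T.src-paint _) (tabulate-cong (cong h ∘ sym ∘ legˡ))
  ; tgt-paint = λ h → trans (U.tgt-paint _) (tabulate-cong (cong h ∘ sym ∘ legʳ))
  ; value-natural = λ { f x@((a , b) , _) w →
      let h , hl , hr , _ = glue x
          _ , _ , _ , unique = glue (recolour (t ⨾ u) f x)
      in sym (unique (f ∘ h) (λ y → trans (cong f (hl y)) (sym (T.value-natural f a y)))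
                             (λ y → trans (cong f (hr y)) (sym (U.value-natural f b y))) w) } }
  where
  module T = Represents Rt
  module U = Represents Ru
  open IsComposite comp
  paint : (Fin (apex e) → Fin q) → Col (t ⨾ u) q
  paint h = (T.paint (h ∘ inl) , U.paint (h ∘ inr)) ,
    trans (T.tgt-paint _) (trans (tabulate-cong (cong h ∘ square)) (sym (U.src-paint _)))
  glue : (a : Col (t ⨾ u) q) → _
  glue ((a , b) , e) = universal _ (T.value a) (U.value b)
    (tabulate-injective (trans (sym (T.tgt-value a)) (trans e (U.src-value b))))

+F-suc : (f : Fin (suc n) → Fin m) (g : Fin p → Fin q) → (f +F g) ∘ suc ≗ ((f ∘ suc) +F g)
+F-suc {n} f g i with splitAt n i
... | inj₁ _ = refl
... | inj₂ _ = refl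

tabulate-+F : {X : Set} (h : Fin (a + b) → X) (f : Fin n → Fin a) (g : Fin m → Fin b) →
              tabulate (h ∘ (f +F g)) ≡ tabulate (h ∘ (_↑ˡ b) ∘ f) ++ tabulate (h ∘ (a ↑ʳ_) ∘ g)
tabulate-+F {n = zero} h f g = refl
tabulate-+F {n = suc n} h f g = cong (_ ∷_)
  (trans (tabulate-cong (cong h ∘ +F-suc f g)) (tabulate-+F h (f ∘ suc) g))

represents-⊕ : {t : Term n m} {u : Term p r} {c : Cospan n m} {d : Cospan p r} →
               Represents t c → Represents u d → Represents (t ⊕ u) (c ⊕C d)
represents-⊕ {t = t} {u} {c} {d} Rt Ru = record
  { paint = λ h → T.paint (h ∘ (_↑ˡ B)) , U.paint (h ∘ (A ↑ʳ_))
  ; value = value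
  ; paint-cong = λ h≗k → cong₂ _,_ (T.paint-cong (h≗k ∘ (_↑ˡ B))) (U.paint-cong (h≗k ∘ (A ↑ʳ_)))
  ; paint-value = λ { (a , b) → cong₂ _,_
      (trans (T.paint-cong λ x → cong [ T.value a , U.value b ] (splitAt-↑ˡ A x B)) (T.paint-value a))
      (trans (U.paint-cong λ y → cong [ T.value a , U.value b ] (splitAt-↑ʳ A B y)) (U.paint-value b)) }
  ; value-paint = value-paint
  ; src-paint = λ h → trans (cong₂ _++_ (T.src-paint _) (U.src-paint _)) (sym (tabulate-+F h (left c) (left d)))
  ; tgt-paint = λ h → trans (cong₂ _++_ (T.tgt-paint _) (U.tgt-paint _)) (sym (tabulate-+F h (right c) (right d)))
  ; value-natural = value-natural }
  where
  module T = Represents Rt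
  module U = Represents Ru
  A = apex c
  B = apex d
  value : Col t q × Col u q → Fin (A + B) → Fin q
  value (a , b) = [ T.value a , U.value b ] ∘ splitAt A
  value-paint : (h : Fin (A + B) → Fin q) → value (T.paint (h ∘ (_↑ˡ B)) , U.paint (h ∘ (A ↑ʳ_))) ≗ h
  value-paint h w with splitAt A w | join-splitAt A B w
  ... | inj₁ x | refl = T.value-paint (h ∘ (_↑ˡ B)) x
  ... | inj₂ y | refl = U.value-paint (h ∘ (A ↑ʳ_)) y
  value-natural : (f : Fin q → Fin s) (a : Col (t ⊕ u) q) → value (recolour (t ⊕ u) f a) ≗ f ∘ value a
  value-natural f (a , b) w with splitAt A w
  ... | inj₁ x = T.value-natural f a x
  ... | inj₂ y = U.value-natural f b y

represents-spider : {t : Term n m} → Spider t → (l : Fin n → Fin 1) (r : Fin m → Fin 1) → Represents t (cospan 1 l r)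
represents-spider S l r = record
  { paint = λ h → fill (h zero)
  ; value = λ a _ → point a
  ; paint-cong = λ h≗k → cong fill (h≗k zero)
  ; paint-value = fill-point
  ; value-paint = λ { h zero → point-fill (h zero) }
  ; src-paint = λ h → trans (src-fill _) (replicate-tabulate h l)
  ; tgt-paint = λ h → trans (tgt-fill _) (replicate-tabulate h r)
  ; value-natural = λ f a _ → point-natural f a }
  where
  open Spider S
  replicate-tabulate : (h : Fin 1 → Fin q) (f : Fin n → Fin 1) → replicate n (h zero) ≡ tabulate (h ∘ f)
  replicate-tabulate {n = zero} h f = refl
  replicate-tabulate {n = suc n} h f with f zero
  ... | zero = cong (h zero ∷_) (replicate-tabulate h (f ∘ suc))

represents-id₀ : Represents id₀ (idC 0)
represents-id₀ = record
  { paint = λ _ → tt ; value = λ _ () ; paint-cong = λ _ → refl ; paint-value = λ _ → refl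
  ; value-paint = λ _ () ; src-paint = λ _ → refl ; tgt-paint = λ _ → refl ; value-natural = λ _ _ () }

graph : (Fin n → Fin m) → Cospan n m
graph f = cospan _ f id

cograph : (Fin n → Fin m) → Cospan m n
cograph f = cospan _ id f

represents-σ : Represents σ (cograph swap₂)
represents-σ = record
  { paint = λ h → h zero , h (suc zero)
  ; value = λ { (x , y) zero → x ; (x , y) (suc zero) → y }
  ; paint-cong = λ h≗k → cong₂ _,_ (h≗k zero) (h≗k (suc zero)) ; paint-value = λ _ → refl
  ; value-paint = λ { h zero → refl ; h (suc zero) → refl }
  ; src-paint = λ _ → refl ; tgt-paint = λ _ → refl
  ; value-natural = λ { f a zero → refl ; f a (suc zero) → refl } }

-- Here the apex is numbered by the output wires, whereas `σC` numbers it by the input wires.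
represents-σ′ : Represents σ (graph swap₂)
represents-σ′ = record
  { paint = λ h → h (suc zero) , h zero
  ; value = λ { (x , y) zero → y ; (x , y) (suc zero) → x }
  ; paint-cong = λ h≗k → cong₂ _,_ (h≗k (suc zero)) (h≗k zero) ; paint-value = λ _ → refl
  ; value-paint = λ { h zero → refl ; h (suc zero) → refl }
  ; src-paint = λ _ → refl ; tgt-paint = λ _ → refl
  ; value-natural = λ { f a zero → refl ; f a (suc zero) → refl } }

-- Equational reasoning about terms

≈-reflexive : {t u : Term n m} → t ≡ u → t ≈ u
≈-reflexive refl = ≈-refl

≈-setoid : ℕ → ℕ → Setoid _ _
≈-setoid n m = record { Carrier = Term n m ; _≈_ = _≈_
  ; isEquivalence = record { refl = ≈-refl ; sym = ≈-sym ; trans = ≈-trans } }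

module ≈-Reasoning {n m} = SetoidReasoning (≈-setoid n m)

-- `idn 1` unfolds to `id₁ ⊕ id₀`, and at literal arities the cast of `⊕-unitʳ` computes away.
⊕-id-id₁ : idn 1 ≈ id₁
⊕-id-id₁ = ⊕-unitʳ id₁

⊕-⨾ˡ : (t : Term n m) (u : Term m p) → (t ⨾ u) ⊕ idn a ≈ (t ⊕ idn a) ⨾ (u ⊕ idn a)
⊕-⨾ˡ t u = ≈-trans (⊕-cong ≈-refl (≈-sym (⨾-idˡ _))) (interchange t u _ _)

id₁⊕-⨾ : (t : Term n m) (u : Term m p) → id₁ ⊕ (t ⨾ u) ≈ (id₁ ⊕ t) ⨾ (id₁ ⊕ u)
id₁⊕-⨾ t u = ≈-trans (⊕-cong (≈-sym id₁⨾id₁) ≈-refl) (interchange _ _ t u)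
  where id₁⨾id₁ = ≈-trans (⨾-cong (≈-sym ⊕-id-id₁) ≈-refl) (⨾-idˡ id₁)

cast-cong : (e : n ≡ a) (e′ : m ≡ b) {t u : Term n m} → t ≈ u → cast e e′ t ≈ cast e e′ u
cast-cong refl refl t≈u = t≈u

-- Reversal of terms

op : Term n m → Term m n
op δ = μ
op ε = η
op μ = δ
op η = ε
op id₀ = id₀
op id₁ = id₁
op σ = σ
op (t ⨾ u) = op u ⨾ op t
op (t ⊕ u) = op t ⊕ op u

op-involutive : (t : Term n m) → op (op t) ≡ t
op-involutive δ = refl
op-involutive ε = refl
op-involutive μ = refl
op-involutive η = refl
op-involutive id₀ = refl
op-involutive id₁ = refl
op-involutive σ = refl
op-involutive (t ⨾ u) = cong₂ _⨾_ (op-involutive t) (op-involutive u)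
op-involutive (t ⊕ u) = cong₂ _⊕_ (op-involutive t) (op-involutive u)

op-idn : ∀ n → op (idn n) ≡ idn n
op-idn zero = refl
op-idn (suc n) = cong (id₁ ⊕_) (op-idn n)

op-cast : (e : n ≡ a) (e′ : m ≡ b) (t : Term n m) → op (cast e e′ t) ≡ cast e′ e (op t)
op-cast refl refl t = refl

σ⨾σ : σ ⨾ σ ≈ idn 2
σ⨾σ = ≈-trans (⨾-cong (≈-sym σ-gen) (≈-sym σ-gen)) (σ-inv 1 1)

-- One-sided on purpose: `op-σn` has a left inverse from `σ-inv`, and `nf-cong` only inserts
-- `t ⨾ op t`.
Unitary : Term n m → Set
Unitary {n} t = t ⨾ op t ≈ idn n

unitary-idn : ∀ n → Unitary (idn n)
unitary-idn n = ≈-trans (⨾-idˡ _) (≈-reflexive (op-idn n))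

unitary-id₁ : Unitary id₁
unitary-id₁ = ≈-trans (⨾-cong (≈-sym ⊕-id-id₁) ≈-refl) (≈-trans (⨾-idˡ id₁) (≈-sym ⊕-id-id₁))

unitary-⨾ : (t : Term n m) (u : Term m p) → Unitary t → Unitary u → Unitary (t ⨾ u)
unitary-⨾ t u Ut Uu = begin
  (t ⨾ u) ⨾ (op u ⨾ op t)   ≈⟨ ⨾-assoc _ _ _ ⟩
  t ⨾ (u ⨾ (op u ⨾ op t))   ≈⟨ ⨾-cong ≈-refl (⨾-assoc _ _ _) ⟨
  t ⨾ (u ⨾ op u ⨾ op t)     ≈⟨ ⨾-cong ≈-refl (⨾-cong Uu ≈-refl) ⟩
  t ⨾ (idn _ ⨾ op t)        ≈⟨ ⨾-cong ≈-refl (⨾-idˡ _) ⟩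
  t ⨾ op t                  ≈⟨ Ut ⟩
  idn _                     ∎
  where open ≈-Reasoning

unitary-⊕ : (t : Term n m) (u : Term p q) → Unitary t → Unitary u → Unitary (t ⊕ u)
unitary-⊕ t u Ut Uu =
  ≈-trans (≈-sym (interchange _ _ _ _)) (≈-trans (⊕-cong Ut Uu) (⊕-id _ _))

unitary-cast : (e : n ≡ a) (e′ : m ≡ b) (t : Term n m) → Unitary t → Unitary (cast e e′ t)
unitary-cast refl refl t Ut = Ut

unitary-σ₁ : ∀ m → Unitary (σ₁ m)
unitary-σ₁ zero = unitary-id₁
unitary-σ₁ (suc m) = unitary-⨾ _ _ (unitary-⊕ σ (idn m) σ⨾σ (unitary-idn m))
                                   (unitary-⊕ id₁ (σ₁ m) unitary-id₁ (unitary-σ₁ m))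

unitary-σn : ∀ n m → Unitary (σn n m)
unitary-σn zero m = unitary-cast refl (sym (+-identityʳ m)) (idn m) (unitary-idn m)
unitary-σn (suc n) m = unitary-⨾ _ _ (unitary-⊕ id₁ (σn n m) unitary-id₁ (unitary-σn n m))
  (unitary-cast refl (+-assoc m 1 n) _ (unitary-⊕ _ _ (unitary-σ₁ m) (unitary-idn n)))

-- The recursion of `σn` is not symmetric, so the two terms differ syntactically; but one is a right
-- and the other a left inverse of `σn n m`.
op-σn : ∀ n m → op (σn n m) ≈ σn m n
op-σn n m = begin
  op (σn n m)                          ≈⟨ ⨾-idˡ _ ⟨
  idn (m + n) ⨾ op (σn n m)            ≈⟨ ⨾-cong (σ-inv m n) ≈-refl ⟨
  σn m n ⨾ σn n m ⨾ op (σn n m)        ≈⟨ ⨾-assoc _ _ _ ⟩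
  σn m n ⨾ (σn n m ⨾ op (σn n m))      ≈⟨ ⨾-cong ≈-refl (unitary-σn n m) ⟩
  σn m n ⨾ idn (n + m)                 ≈⟨ ⨾-idʳ _ ⟩
  σn m n                               ∎
  where open ≈-Reasoning

-- The axioms are closed under reversal: it exchanges the two hexagons, the monoid with the comonoid
-- axioms, and the two Frobenius laws. Mirror images of later equations thus come for free.
op-resp-≈ : {t u : Term n m} → t ≈ u → op t ≈ op u
op-resp-≈ ≈-refl = ≈-refl
op-resp-≈ (≈-sym t≈u) = ≈-sym (op-resp-≈ t≈u)
op-resp-≈ (≈-trans t≈u u≈v) = ≈-trans (op-resp-≈ t≈u) (op-resp-≈ u≈v)
op-resp-≈ (⨾-cong e f) = ⨾-cong (op-resp-≈ f) (op-resp-≈ e)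
op-resp-≈ (⊕-cong e f) = ⊕-cong (op-resp-≈ e) (op-resp-≈ f)
op-resp-≈ (⨾-assoc c d e) = ≈-sym (⨾-assoc (op e) (op d) (op c))
op-resp-≈ (⨾-idˡ c) = ≈-trans (⨾-cong ≈-refl (≈-reflexive (op-idn _))) (⨾-idʳ (op c))
op-resp-≈ (⨾-idʳ c) = ≈-trans (⨾-cong (≈-reflexive (op-idn _)) ≈-refl) (⨾-idˡ (op c))
op-resp-≈ (⊕-assoc {n} {m} {p} {q} {r} {s} c d e) =
  ≈-trans (≈-reflexive (op-cast (+-assoc n p r) (+-assoc m q s) _)) (⊕-assoc (op c) (op d) (op e))
op-resp-≈ (⊕-unitˡ c) = ⊕-unitˡ (op c)
op-resp-≈ (⊕-unitʳ {n} {m} c) =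
  ≈-trans (≈-reflexive (op-cast (+-identityʳ n) (+-identityʳ m) _)) (⊕-unitʳ (op c))
op-resp-≈ (⊕-id n m) = begin
  op (idn n) ⊕ op (idn m)  ≡⟨ cong₂ _⊕_ (op-idn n) (op-idn m) ⟩
  idn n ⊕ idn m            ≈⟨ ⊕-id n m ⟩
  idn (n + m)              ≡⟨ op-idn (n + m) ⟨
  op (idn (n + m))         ∎
  where open ≈-Reasoning
op-resp-≈ (interchange c d c′ d′) = interchange (op d) (op c) (op d′) (op c′)
op-resp-≈ σ-gen = ≈-trans (op-σn 1 1) σ-gen
op-resp-≈ (σ-nat {n} {m} {p} {q} c d) = begin
  op (σn m q) ⨾ (op c ⊕ op d)  ≈⟨ ⨾-cong (op-σn m q) ≈-refl ⟩
  σn q m ⨾ (op c ⊕ op d)       ≈⟨ σ-nat (op d) (op c) ⟨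
  (op d ⊕ op c) ⨾ σn p n       ≈⟨ ⨾-cong ≈-refl (op-σn n p) ⟨
  (op d ⊕ op c) ⨾ op (σn n p)  ∎
  where open ≈-Reasoning
op-resp-≈ (σ-inv n m) = ≈-trans (⨾-cong (op-σn m n) (op-σn n m))
  (≈-trans (σ-inv n m) (≈-reflexive (sym (op-idn (n + m)))))
op-resp-≈ (σ-hex₁ n m p) = begin
  op (σn (n + m) p)                            ≈⟨ op-σn (n + m) p ⟩
  σn p (n + m)                                 ≈⟨ σ-hex₂ p n m ⟩
  cast (+-assoc p n m) (sym (+-assoc n m p)) (cast refl (+-assoc n p m) (σn p n ⊕ idn m) ⨾ (idn n ⊕ σn p m))
    ≈⟨ cast-cong (+-assoc p n m) (sym (+-assoc n m p)) (⨾-cong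
         (≈-trans (≈-reflexive (op-cast (+-assoc n p m) refl (σn n p ⊕ idn m)))
           (cast-cong refl (+-assoc n p m) (⊕-cong (op-σn n p) (≈-reflexive (op-idn m)))))
         (⊕-cong (≈-reflexive (op-idn n)) (op-σn m p))) ⟨
  cast (+-assoc p n m) (sym (+-assoc n m p)) (op ((idn n ⊕ σn m p) ⨾ cast (+-assoc n p m) refl (σn n p ⊕ idn m)))
    ≡⟨ op-cast (sym (+-assoc n m p)) (+-assoc p n m) ((idn n ⊕ σn m p) ⨾ cast (+-assoc n p m) refl (σn n p ⊕ idn m)) ⟨
  op (cast (sym (+-assoc n m p)) (+-assoc p n m) ((idn n ⊕ σn m p) ⨾ cast (+-assoc n p m) refl (σn n p ⊕ idn m))) ∎
  where open ≈-Reasoning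
op-resp-≈ (σ-hex₂ n m p) = begin
  op (σn n (m + p))                            ≈⟨ op-σn n (m + p) ⟩
  σn (m + p) n                                 ≈⟨ σ-hex₁ m p n ⟩
  cast (sym (+-assoc m p n)) (+-assoc n m p) ((idn m ⊕ σn p n) ⨾ cast (+-assoc m n p) refl (σn m n ⊕ idn p))
    ≈⟨ cast-cong (sym (+-assoc m p n)) (+-assoc n m p) (⨾-cong
         (⊕-cong (≈-reflexive (op-idn m)) (op-σn n p))
         (≈-trans (≈-reflexive (op-cast refl (+-assoc m n p) (σn n m ⊕ idn p)))
           (cast-cong (+-assoc m n p) refl (⊕-cong (op-σn n m) (≈-reflexive (op-idn p)))))) ⟨
  cast (sym (+-assoc m p n)) (+-assoc n m p) (op (cast refl (+-assoc m n p) (σn n m ⊕ idn p) ⨾ (idn m ⊕ σn n p)))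
    ≡⟨ op-cast (+-assoc n m p) (sym (+-assoc m p n)) (cast refl (+-assoc m n p) (σn n m ⊕ idn p) ⨾ (idn m ⊕ σn n p)) ⟨
  op (cast (+-assoc n m p) (sym (+-assoc m p n)) (cast refl (+-assoc m n p) (σn n m ⊕ idn p) ⨾ (idn m ⊕ σn n p))) ∎
  where open ≈-Reasoning
op-resp-≈ δ-assoc = μ-assoc
op-resp-≈ δ-unit = μ-unit
op-resp-≈ δ-comm = μ-comm
op-resp-≈ μ-assoc = δ-assoc
op-resp-≈ μ-unit = δ-unit
op-resp-≈ μ-comm = δ-comm
op-resp-≈ frob₁ = ≈-sym frob₂
op-resp-≈ frob₂ = ≈-sym frob₁
op-resp-≈ special = special

-- Paths of terms

-- Composites are kept as lists of factors, so that rebracketing is definitional and a segment can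
-- be rewritten in place.
Path : ℕ → ℕ → Set
Path = Star Term

⟦_⟧ : Path n m → Term n m
⟦ [] ⟧ = idn _
⟦ t ◅ ts ⟧ = t ⨾ ⟦ ts ⟧

infix 4 _≋_
-- A record, because the two paths could not be inferred from an equation between their values under
-- `⟦_⟧`.
record _≋_ (ts us : Path n m) : Set where
  constructor ⟪_⟫
  field ≋⇒≈ : ⟦ ts ⟧ ≈ ⟦ us ⟧
open _≋_

≋-refl : {ts : Path n m} → ts ≋ ts
≋-refl = ⟪ ≈-refl ⟫

≋-sym : {ts us : Path n m} → ts ≋ us → us ≋ ts
≋-sym ⟪ e ⟫ = ⟪ ≈-sym e ⟫

≋-trans : {ts us vs : Path n m} → ts ≋ us → us ≋ vs → ts ≋ vs
≋-trans ⟪ e ⟫ ⟪ f ⟫ = ⟪ ≈-trans e f ⟫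

≋-setoid : ℕ → ℕ → Setoid _ _
≋-setoid n m = record { Carrier = Path n m ; _≈_ = _≋_
  ; isEquivalence = record { refl = ≋-refl ; sym = ≋-sym ; trans = ≋-trans } }

module ≋-Reasoning {n m} = SetoidReasoning (≋-setoid n m)

⟦⟧-◅◅ : (ts : Path n m) (us : Path m p) → ⟦ ts ◅◅ us ⟧ ≈ ⟦ ts ⟧ ⨾ ⟦ us ⟧
⟦⟧-◅◅ [] us = ≈-sym (⨾-idˡ _)
⟦⟧-◅◅ (t ◅ ts) us = ≈-trans (⨾-cong ≈-refl (⟦⟧-◅◅ ts us)) (≈-sym (⨾-assoc _ _ _))

◅◅-cong : {ts ts′ : Path n m} {us us′ : Path m p} → ts ≋ ts′ → us ≋ us′ → ts ◅◅ us ≋ ts′ ◅◅ us′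
◅◅-cong {ts = ts} {ts′} {us} {us′} ⟪ e ⟫ ⟪ f ⟫ =
  ⟪ ≈-trans (⟦⟧-◅◅ ts us) (≈-trans (⨾-cong e f) (≈-sym (⟦⟧-◅◅ ts′ us′))) ⟫

-- The length of the explicit prefix selects the place of the rewriting; its entries can be left to
-- inference.
inside : (ts : Path a b) {us us′ : Path b c} {vs : Path c d} →
         us ≋ us′ → ts ◅◅ us ◅◅ vs ≋ ts ◅◅ us′ ◅◅ vs
inside ts us≋us′ = ◅◅-cong (≋-refl {ts = ts}) (◅◅-cong us≋us′ ≋-refl)

single : {t u : Term n m} → t ≈ u → t ◅ [] ≋ u ◅ []
single e = ⟪ ⨾-cong e ≈-refl ⟫

unsingle : {t u : Term n m} → t ◅ [] ≋ u ◅ [] → t ≈ u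
unsingle ⟪ e ⟫ = ≈-trans (≈-sym (⨾-idʳ _)) (≈-trans e (⨾-idʳ _))

compose : (t : Term n m) (u : Term m p) → t ◅ u ◅ [] ≋ t ⨾ u ◅ []
compose t u = ⟪ ≈-sym (⨾-assoc _ _ _) ⟫

erase : {t : Term n n} → t ≈ idn n → t ◅ [] ≋ []
erase e = ⟪ ≈-trans (⨾-idʳ _) e ⟫

liftᴾ : Path n m → Path (suc n) (suc m)
liftᴾ = gmap suc (id₁ ⊕_)

⟦⟧-lift : (ts : Path n m) → ⟦ liftᴾ ts ⟧ ≈ id₁ ⊕ ⟦ ts ⟧
⟦⟧-lift [] = ≈-refl
⟦⟧-lift (t ◅ ts) = ≈-trans (⨾-cong ≈-refl (⟦⟧-lift ts)) (≈-sym (id₁⊕-⨾ _ _))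

lift-cong : {ts us : Path n m} → ts ≋ us → liftᴾ ts ≋ liftᴾ us
lift-cong {ts = ts} {us} ⟪ e ⟫ =
  ⟪ ≈-trans (⟦⟧-lift ts) (≈-trans (⊕-cong ≈-refl e) (≈-sym (⟦⟧-lift us))) ⟫

padᴾ : ∀ a → Path n m → Path (n + a) (m + a)
padᴾ a = gmap (_+ a) (_⊕ idn a)

⟦⟧-pad : ∀ a (ts : Path n m) → ⟦ padᴾ a ts ⟧ ≈ ⟦ ts ⟧ ⊕ idn a
⟦⟧-pad a [] = ≈-sym (⊕-id _ _)
⟦⟧-pad a (t ◅ ts) = ≈-trans (⨾-cong ≈-refl (⟦⟧-pad a ts)) (≈-sym (⊕-⨾ˡ _ _))

pad-cong : ∀ a {ts us : Path n m} → ts ≋ us → padᴾ a ts ≋ padᴾ a us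
pad-cong a {ts} {us} ⟪ e ⟫ =
  ⟪ ≈-trans (⟦⟧-pad a ts) (≈-trans (⊕-cong e ≈-refl) (≈-sym (⟦⟧-pad a us))) ⟫

opᴾ : Path n m → Path m n
opᴾ [] = []
opᴾ (t ◅ ts) = opᴾ ts ◅◅ op t ◅ []

⟦⟧-op : (ts : Path n m) → ⟦ opᴾ ts ⟧ ≈ op ⟦ ts ⟧
⟦⟧-op [] = ≈-reflexive (sym (op-idn _))
⟦⟧-op (t ◅ ts) = ≈-trans (⟦⟧-◅◅ (opᴾ ts) _) (⨾-cong (⟦⟧-op ts) (⨾-idʳ _))

opᴾ-cong : {ts us : Path n m} → ts ≋ us → opᴾ ts ≋ opᴾ us
opᴾ-cong {ts = ts} {us} ⟪ e ⟫ =
  ⟪ ≈-trans (⟦⟧-op ts) (≈-trans (op-resp-≈ e) (≈-sym (⟦⟧-op us))) ⟫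

-- Equal to `idn a ⊕ t` by `idn⊕`, but at a literal `a` it unfolds to nested `id₁ ⊕`, the shape that
-- occurs in the paths below.
lift^ : ∀ a → Term n m → Term (a + n) (a + m)
lift^ zero t = t
lift^ (suc a) t = id₁ ⊕ lift^ a t

idn⊕ : ∀ a (t : Term n m) → idn a ⊕ t ≈ lift^ a t
idn⊕ zero t = ⊕-unitˡ t
idn⊕ (suc a) t = ≈-trans (⊕-assoc id₁ (idn a) t) (⊕-cong ≈-refl (idn⊕ a t))

slide : (g : Term a b) (t : Term n m) →
        (g ⊕ idn n) ◅ lift^ b t ◅ [] ≋ lift^ a t ◅ (g ⊕ idn m) ◅ []
slide {a} {b} {n} {m} g t = ≋-trans (compose _ _) (≋-trans (single (begin
  (g ⊕ idn n) ⨾ lift^ b t      ≈⟨ ⨾-cong ≈-refl (idn⊕ b t) ⟨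
  (g ⊕ idn n) ⨾ (idn b ⊕ t)    ≈⟨ interchange _ _ _ _ ⟨
  (g ⨾ idn b) ⊕ (idn n ⨾ t)    ≈⟨ ⊕-cong (⨾-idʳ g) (⨾-idˡ t) ⟩
  g ⊕ t                        ≈⟨ ⊕-cong (⨾-idˡ g) (⨾-idʳ t) ⟨
  (idn a ⨾ g) ⊕ (t ⨾ idn m)    ≈⟨ interchange _ _ _ _ ⟩
  (idn a ⊕ t) ⨾ (g ⊕ idn m)    ≈⟨ ⨾-cong (idn⊕ a t) ≈-refl ⟩
  lift^ a t ⨾ (g ⊕ idn m)      ∎)) (≋-sym (compose _ _)))
  where open ≈-Reasoning

-- Equations between generators on the first wires

σn-1-2 : σn 1 2 ≈ (σ ⊕ id₁) ⨾ (id₁ ⊕ σ)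
σn-1-2 = begin
  idn 3 ⨾ (((σ ⊕ idn 1) ⨾ (id₁ ⊕ ((σ ⊕ id₀) ⨾ (id₁ ⊕ id₁)))) ⊕ id₀)  ≈⟨ ⨾-idˡ _ ⟩
  ((σ ⊕ idn 1) ⨾ (id₁ ⊕ ((σ ⊕ id₀) ⨾ (id₁ ⊕ id₁)))) ⊕ id₀            ≈⟨ ⊕-unitʳ _ ⟩
  (σ ⊕ idn 1) ⨾ (id₁ ⊕ ((σ ⊕ id₀) ⨾ (id₁ ⊕ id₁)))
    ≈⟨ ⨾-cong (⊕-cong ≈-refl ⊕-id-id₁) (⊕-cong ≈-refl (⨾-cong (⊕-unitʳ σ) (⊕-cong ≈-refl (≈-sym ⊕-id-id₁)))) ⟩
  (σ ⊕ id₁) ⨾ (id₁ ⊕ (σ ⨾ idn 2))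
    ≈⟨ ⨾-cong ≈-refl (⊕-cong ≈-refl (⨾-idʳ σ)) ⟩
  (σ ⊕ id₁) ⨾ (id₁ ⊕ σ)                                              ∎
  where open ≈-Reasoning

σn-2-1 : σn 2 1 ≈ (id₁ ⊕ σ) ⨾ (σ ⊕ id₁)
σn-2-1 = ⨾-cong (⊕-cong ≈-refl σ-gen) (begin
  ((σ ⊕ id₀) ⨾ (id₁ ⊕ id₁)) ⊕ idn 1
    ≈⟨ ⊕-cong (⨾-cong (⊕-unitʳ σ) (⊕-cong ≈-refl (≈-sym ⊕-id-id₁))) ⊕-id-id₁ ⟩
  (σ ⨾ idn 2) ⊕ id₁  ≈⟨ ⊕-cong (⨾-idʳ σ) ≈-refl ⟩
  σ ⊕ id₁            ∎)
  where open ≈-Reasoning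

compose₃ : (t : Term n m) (u : Term m p) (v : Term p q) → t ◅ u ◅ v ◅ [] ≋ t ⨾ u ⨾ v ◅ []
compose₃ t u v = ≋-trans (inside [] (compose t u)) (compose (t ⨾ u) v)

σ-inverse : ∀ n → (σ ⊕ idn n) ◅ (σ ⊕ idn n) ◅ [] ≋ []
σ-inverse n = pad-cong n {σ ◅ σ ◅ []} {[]} (≋-trans (compose σ σ) (erase σ⨾σ))

module _ (n : ℕ) where
  private
    -- At every use the arity of g is a literal, so that the cast reduces away.
    ⊕id₁ : (g : Term a b) → cast (+-assoc a 1 n) (+-assoc b 1 n) ((g ⊕ id₁) ⊕ idn n) ≈ g ⊕ idn (suc n)
    ⊕id₁ g = ⊕-assoc g id₁ (idn n)

    id₁⊕ : (g : Term a b) → (id₁ ⊕ g) ⊕ idn n ≈ id₁ ⊕ (g ⊕ idn n)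
    id₁⊕ g = ⊕-assoc id₁ g (idn n)

    _∙_ : {t u : Term a b} {ts us : Path b c} → t ≈ u → ts ≋ us → t ◅ ts ≋ u ◅ us
    e ∙ f = ◅◅-cong (single e) f
    infixr 5 _∙_

    -- Extends an equation between bare generators to `n` further wires; the outer arguments bring
    -- the padding into the shape `g ⊕ idn (suc n)` or `id₁ ⊕ (g ⊕ idn n)`.
    via : {ts us : Path (a + n) (b + n)} {ts′ us′ : Path a b} →
          padᴾ n ts′ ≋ ts → ts′ ≋ us′ → padᴾ n us′ ≋ us → ts ≋ us
    via e f g = ≋-trans (≋-sym e) (≋-trans (pad-cong n f) g)

  -- The Yang-Baxter equation, which is naturality of `σn 2 1` at `σ`.
  σ-braid : (σ ⊕ idn (suc n)) ◅ (id₁ ⊕ (σ ⊕ idn n)) ◅ (σ ⊕ idn (suc n)) ◅ []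
          ≋ (id₁ ⊕ (σ ⊕ idn n)) ◅ (σ ⊕ idn (suc n)) ◅ (id₁ ⊕ (σ ⊕ idn n)) ◅ []
  σ-braid = via (⊕id₁ σ ∙ id₁⊕ σ ∙ ⊕id₁ σ ∙ ≋-refl) (begin
    (σ ⊕ id₁) ◅ (id₁ ⊕ σ) ◅ (σ ⊕ id₁) ◅ []  ≈⟨ inside (_ ◅ []) (compose _ _) ⟩
    (σ ⊕ id₁) ◅ (id₁ ⊕ σ) ⨾ (σ ⊕ id₁) ◅ []  ≈⟨ inside (_ ◅ []) (single σn-2-1) ⟨
    (σ ⊕ id₁) ◅ σn 2 1 ◅ []                 ≈⟨ compose _ _ ⟩
    (σ ⊕ id₁) ⨾ σn 2 1 ◅ []                 ≈⟨ single (σ-nat σ id₁) ⟩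
    σn 2 1 ⨾ (id₁ ⊕ σ) ◅ []                 ≈⟨ single (⨾-cong σn-2-1 ≈-refl) ⟩
    (id₁ ⊕ σ) ⨾ (σ ⊕ id₁) ⨾ (id₁ ⊕ σ) ◅ []  ≈⟨ compose₃ _ _ _ ⟨
    (id₁ ⊕ σ) ◅ (σ ⊕ id₁) ◅ (id₁ ⊕ σ) ◅ []  ∎) (id₁⊕ σ ∙ ⊕id₁ σ ∙ id₁⊕ σ ∙ ≋-refl)
    where open ≋-Reasoning

  μ-slide : (μ ⊕ idn (suc n)) ◅ (σ ⊕ idn n) ◅ []
          ≋ (id₁ ⊕ (σ ⊕ idn n)) ◅ (σ ⊕ idn (suc n)) ◅ (id₁ ⊕ (μ ⊕ idn n)) ◅ []
  μ-slide = via (⊕id₁ μ ∙ ≋-refl) (begin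
    (μ ⊕ id₁) ◅ σ ◅ []                      ≈⟨ compose _ _ ⟩
    (μ ⊕ id₁) ⨾ σ ◅ []                      ≈⟨ single (⨾-cong ≈-refl σ-gen) ⟨
    (μ ⊕ id₁) ⨾ σn 1 1 ◅ []                 ≈⟨ single (σ-nat μ id₁) ⟩
    σn 2 1 ⨾ (id₁ ⊕ μ) ◅ []                 ≈⟨ single (⨾-cong σn-2-1 ≈-refl) ⟩
    (id₁ ⊕ σ) ⨾ (σ ⊕ id₁) ⨾ (id₁ ⊕ μ) ◅ []  ≈⟨ compose₃ _ _ _ ⟨
    (id₁ ⊕ σ) ◅ (σ ⊕ id₁) ◅ (id₁ ⊕ μ) ◅ []  ∎) (id₁⊕ σ ∙ ⊕id₁ σ ∙ id₁⊕ μ ∙ ≋-refl)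
    where open ≋-Reasoning

  μ-slide′ : (id₁ ⊕ (μ ⊕ idn n)) ◅ (σ ⊕ idn n) ◅ []
           ≋ (σ ⊕ idn (suc n)) ◅ (id₁ ⊕ (σ ⊕ idn n)) ◅ (μ ⊕ idn (suc n)) ◅ []
  μ-slide′ = via (id₁⊕ μ ∙ ≋-refl) (begin
    (id₁ ⊕ μ) ◅ σ ◅ []                      ≈⟨ compose _ _ ⟩
    (id₁ ⊕ μ) ⨾ σ ◅ []                      ≈⟨ single (⨾-cong ≈-refl σ-gen) ⟨
    (id₁ ⊕ μ) ⨾ σn 1 1 ◅ []                 ≈⟨ single (σ-nat id₁ μ) ⟩
    σn 1 2 ⨾ (μ ⊕ id₁) ◅ []                 ≈⟨ single (⨾-cong σn-1-2 ≈-refl) ⟩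
    (σ ⊕ id₁) ⨾ (id₁ ⊕ σ) ⨾ (μ ⊕ id₁) ◅ []  ≈⟨ compose₃ _ _ _ ⟨
    (σ ⊕ id₁) ◅ (id₁ ⊕ σ) ◅ (μ ⊕ id₁) ◅ []  ∎) (⊕id₁ σ ∙ id₁⊕ σ ∙ ⊕id₁ μ ∙ ≋-refl)
    where open ≋-Reasoning

  η-slide : (η ⊕ idn (suc n)) ◅ (σ ⊕ idn n) ◅ [] ≋ (id₁ ⊕ (η ⊕ idn n)) ◅ []
  η-slide = via (⊕id₁ η ∙ ≋-refl) (begin
    (η ⊕ id₁) ◅ σ ◅ []       ≈⟨ compose _ _ ⟩
    (η ⊕ id₁) ⨾ σ ◅ []       ≈⟨ single (⨾-cong ≈-refl σ-gen) ⟨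
    (η ⊕ id₁) ⨾ σn 1 1 ◅ []  ≈⟨ single (σ-nat η id₁) ⟩
    idn 1 ⨾ (id₁ ⊕ η) ◅ []   ≈⟨ single (⨾-idˡ _) ⟩
    (id₁ ⊕ η) ◅ []           ∎) (id₁⊕ η ∙ ≋-refl)
    where open ≋-Reasoning

  -- Naturality of the symmetry at `δ`, with one crossing carried to the other side by involutivity.
  δ-slide : (δ ⊕ idn (suc n)) ◅ (id₁ ⊕ (σ ⊕ idn n)) ◅ []
          ≋ (σ ⊕ idn n) ◅ (id₁ ⊕ (δ ⊕ idn n)) ◅ (σ ⊕ idn (suc n)) ◅ []
  δ-slide = via (⊕id₁ δ ∙ id₁⊕ σ ∙ ≋-refl) (begin
    (δ ⊕ id₁) ◅ (id₁ ⊕ σ) ◅ []                      ≈⟨ ≋-refl ⟩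
    [] ◅◅ ((δ ⊕ id₁) ◅ (id₁ ⊕ σ) ◅ [])              ≈⟨ inside ((δ ⊕ id₁) ◅ (id₁ ⊕ σ) ◅ []) σσ ⟨
    (δ ⊕ id₁) ◅ (id₁ ⊕ σ) ◅ (σ ⊕ id₁) ◅ (σ ⊕ id₁) ◅ [] ≈⟨ inside (_ ◅ []) (compose _ _) ⟩
    (δ ⊕ id₁) ◅ (id₁ ⊕ σ) ⨾ (σ ⊕ id₁) ◅ (σ ⊕ id₁) ◅ [] ≈⟨ inside (_ ◅ []) (single σn-2-1) ⟨
    (δ ⊕ id₁) ◅ σn 2 1 ◅ (σ ⊕ id₁) ◅ []             ≈⟨ inside [] (compose _ _) ⟩
    (δ ⊕ id₁) ⨾ σn 2 1 ◅ (σ ⊕ id₁) ◅ []             ≈⟨ inside [] (single (σ-nat δ id₁)) ⟩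
    σn 1 1 ⨾ (id₁ ⊕ δ) ◅ (σ ⊕ id₁) ◅ []             ≈⟨ inside [] (single (⨾-cong σ-gen ≈-refl)) ⟩
    σ ⨾ (id₁ ⊕ δ) ◅ (σ ⊕ id₁) ◅ []                  ≈⟨ inside [] (compose _ _) ⟨
    σ ◅ (id₁ ⊕ δ) ◅ (σ ⊕ id₁) ◅ []                  ∎) (≈-refl ∙ id₁⊕ δ ∙ ⊕id₁ σ ∙ ≋-refl)
    where
    open ≋-Reasoning
    σσ : (σ ⊕ id₁) ◅ (σ ⊕ id₁) ◅ [] ≋ []
    σσ = ≋-trans (◅◅-cong (single e) (single e)) (σ-inverse 1)
      where e = ⊕-cong ≈-refl (≈-sym ⊕-id-id₁)

  μ-associative : (μ ⊕ idn (suc n)) ◅ (μ ⊕ idn n) ◅ [] ≋ (id₁ ⊕ (μ ⊕ idn n)) ◅ (μ ⊕ idn n) ◅ []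
  μ-associative = via (⊕id₁ μ ∙ ≋-refl)
    (≋-trans (compose _ _) (≋-trans (single μ-assoc) (≋-sym (compose _ _)))) (id₁⊕ μ ∙ ≋-refl)

  μ-commutative : (σ ⊕ idn n) ◅ (μ ⊕ idn n) ◅ [] ≋ (μ ⊕ idn n) ◅ []
  μ-commutative = via ≋-refl (≋-trans (compose _ _) (single μ-comm)) ≋-refl

  μ-unital : (η ⊕ idn (suc n)) ◅ (μ ⊕ idn n) ◅ [] ≋ []
  μ-unital = via (⊕id₁ η ∙ ≋-refl) (≋-trans (compose _ _) (erase (≈-trans μ-unit (≈-sym ⊕-id-id₁)))) ≋-refl

  μ-special : (δ ⊕ idn n) ◅ (μ ⊕ idn n) ◅ [] ≋ []
  μ-special = via ≋-refl (≋-trans (compose _ _) (erase (≈-trans special (≈-sym ⊕-id-id₁)))) ≋-refl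

  frobenius : (δ ⊕ idn (suc n)) ◅ (id₁ ⊕ (μ ⊕ idn n)) ◅ [] ≋ (μ ⊕ idn n) ◅ (δ ⊕ idn n) ◅ []
  frobenius = via (⊕id₁ δ ∙ id₁⊕ μ ∙ ≋-refl)
    (≋-trans (compose _ _) (≋-trans (single frob₁) (≋-sym (compose _ _)))) ≋-refl

  -- Sliding the crossing through `δ` leaves a crossing before `μ` and another one in front;
  -- commutativity of `μ` absorbs both.
  frobenius-σ : (id₁ ⊕ (δ ⊕ idn n)) ◅ (σ ⊕ idn (suc n)) ◅ (id₁ ⊕ (μ ⊕ idn n)) ◅ []
              ≋ (μ ⊕ idn n) ◅ (δ ⊕ idn n) ◅ []
  frobenius-σ = begin
    (id₁ ⊕ (δ ⊕ idn n)) ◅ (σ ⊕ idn (suc n)) ◅ (id₁ ⊕ (μ ⊕ idn n)) ◅ []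
      ≈⟨ inside [] (σ-inverse n) ⟨
    (σ ⊕ idn n) ◅ (σ ⊕ idn n) ◅ (id₁ ⊕ (δ ⊕ idn n)) ◅ (σ ⊕ idn (suc n)) ◅ (id₁ ⊕ (μ ⊕ idn n)) ◅ []
      ≈⟨ inside (_ ◅ []) δ-slide ⟨
    (σ ⊕ idn n) ◅ (δ ⊕ idn (suc n)) ◅ (id₁ ⊕ (σ ⊕ idn n)) ◅ (id₁ ⊕ (μ ⊕ idn n)) ◅ []
      ≈⟨ inside (_ ◅ _ ◅ []) (lift-cong μ-commutative) ⟩
    (σ ⊕ idn n) ◅ (δ ⊕ idn (suc n)) ◅ (id₁ ⊕ (μ ⊕ idn n)) ◅ []
      ≈⟨ inside (_ ◅ []) frobenius ⟩
    (σ ⊕ idn n) ◅ (μ ⊕ idn n) ◅ (δ ⊕ idn n) ◅ []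
      ≈⟨ inside [] μ-commutative ⟩
    (μ ⊕ idn n) ◅ (δ ⊕ idn n) ◅ [] ∎
    where open ≋-Reasoning

open ≋-Reasoning

-- Merging a wire into another one

-- Lets an additional first wire run into wire x.
join : Fin n → Term (suc n) n
join {suc n} zero = μ ⊕ idn n
join {suc n} (suc x) = (σ ⊕ idn n) ⨾ (id₁ ⊕ join x)

split : Fin n → Term n (suc n)
split {suc n} zero = δ ⊕ idn n
split {suc n} (suc x) = (id₁ ⊕ split x) ⨾ (σ ⊕ idn n)

op-join : (x : Fin n) → op (join x) ≡ split x
op-join {suc n} zero = cong (δ ⊕_) (op-idn n)
op-join {suc n} (suc x) = cong₂ (λ t i → (id₁ ⊕ t) ⨾ (σ ⊕ i)) (op-join x) (op-idn n)

op-split : (x : Fin n) → op (split x) ≡ join x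
op-split x = ≡.trans (cong op (sym (op-join x))) (op-involutive (join x))

join-suc : (x : Fin n) → join (suc x) ◅ [] ≋ (σ ⊕ idn n) ◅ (id₁ ⊕ join x) ◅ []
join-suc x = ≋-sym (compose _ _)

split-suc : (x : Fin n) → split (suc x) ◅ [] ≋ (id₁ ⊕ split x) ◅ (σ ⊕ idn n) ◅ []
split-suc x = ≋-sym (compose _ _)

-- The crossing is an involution, so the claims for `x , y` and for `y , x` are equivalent.
join-join-sym : {x y : Fin n} →
  (id₁ ⊕ join x) ◅ join y ◅ [] ≋ (σ ⊕ idn n) ◅ (id₁ ⊕ join y) ◅ join x ◅ [] →
  (id₁ ⊕ join y) ◅ join x ◅ [] ≋ (σ ⊕ idn n) ◅ (id₁ ⊕ join x) ◅ join y ◅ []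
join-join-sym {n} {x} {y} e =
  ≋-trans (≋-sym (inside [] (σ-inverse n))) (inside (_ ◅ []) (≋-sym e))

-- When both extra wires run into the first one, this is associativity and commutativity of `μ`.
-- Otherwise naturality moves the crossings out of the way, and Yang-Baxter is used when neither
-- target is the first wire.
join-join : (x y : Fin n) →
  (id₁ ⊕ join x) ◅ join y ◅ [] ≋ (σ ⊕ idn n) ◅ (id₁ ⊕ join y) ◅ join x ◅ []
join-join {suc n} zero zero = begin
  (id₁ ⊕ (μ ⊕ idn n)) ◅ (μ ⊕ idn n) ◅ []                      ≈⟨ μ-associative n ⟨
  (μ ⊕ idn (suc n)) ◅ (μ ⊕ idn n) ◅ []                        ≈⟨ inside [] (μ-commutative (suc n)) ⟨
  (σ ⊕ idn (suc n)) ◅ (μ ⊕ idn (suc n)) ◅ (μ ⊕ idn n) ◅ []    ≈⟨ inside (_ ◅ []) (μ-associative n) ⟩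
  (σ ⊕ idn (suc n)) ◅ (id₁ ⊕ (μ ⊕ idn n)) ◅ (μ ⊕ idn n) ◅ []  ∎
join-join {suc (suc n)} zero (suc y) = begin
  (id₁ ⊕ (μ ⊕ idn (suc n))) ◅ join (suc y) ◅ []
    ≈⟨ inside (_ ◅ []) (join-suc y) ⟩
  (id₁ ⊕ (μ ⊕ idn _)) ◅ (σ ⊕ idn _) ◅ (id₁ ⊕ join y) ◅ []
    ≈⟨ inside [] (μ-slide′ _) ⟩
  (σ ⊕ idn _) ◅ (id₁ ⊕ (σ ⊕ idn _)) ◅ (μ ⊕ idn _) ◅ (id₁ ⊕ join y) ◅ []
    ≈⟨ inside (_ ◅ _ ◅ []) (slide μ (join y)) ⟩
  (σ ⊕ idn _) ◅ (id₁ ⊕ (σ ⊕ idn _)) ◅ (id₁ ⊕ (id₁ ⊕ join y)) ◅ (μ ⊕ idn (suc n)) ◅ []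
    ≈⟨ inside (_ ◅ []) (lift-cong (join-suc y)) ⟨
  (σ ⊕ idn _) ◅ (id₁ ⊕ join (suc y)) ◅ (μ ⊕ idn (suc n)) ◅ []                              ∎
join-join {suc (suc n)} (suc x) zero = join-join-sym (join-join zero (suc x))
join-join {suc (suc n)} (suc x) (suc y) = begin
  (id₁ ⊕ join (suc x)) ◅ join (suc y) ◅ []
    ≈⟨ inside [] (lift-cong (join-suc x)) ⟩
  (id₁ ⊕ (σ ⊕ idn _)) ◅ (id₁ ⊕ (id₁ ⊕ join x)) ◅ join (suc y) ◅ []
    ≈⟨ inside (_ ◅ _ ◅ []) (join-suc y) ⟩
  (id₁ ⊕ (σ ⊕ idn _)) ◅ (id₁ ⊕ (id₁ ⊕ join x)) ◅ (σ ⊕ idn _) ◅ (id₁ ⊕ join y) ◅ []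
    ≈⟨ inside (_ ◅ []) (slide σ (join x)) ⟨
  (id₁ ⊕ (σ ⊕ idn _)) ◅ (σ ⊕ idn _) ◅ (id₁ ⊕ (id₁ ⊕ join x)) ◅ (id₁ ⊕ join y) ◅ []
    ≈⟨ inside (_ ◅ _ ◅ []) (lift-cong (join-join x y)) ⟩
  (id₁ ⊕ (σ ⊕ idn _)) ◅ (σ ⊕ idn _) ◅ (id₁ ⊕ (σ ⊕ idn _)) ◅ (id₁ ⊕ (id₁ ⊕ join y)) ◅ (id₁ ⊕ join x) ◅ []
    ≈⟨ inside [] (σ-braid _) ⟨
  (σ ⊕ idn _) ◅ (id₁ ⊕ (σ ⊕ idn _)) ◅ (σ ⊕ idn _) ◅ (id₁ ⊕ (id₁ ⊕ join y)) ◅ (id₁ ⊕ join x) ◅ []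
    ≈⟨ inside (_ ◅ _ ◅ []) (slide σ (join y)) ⟩
  (σ ⊕ idn _) ◅ (id₁ ⊕ (σ ⊕ idn _)) ◅ (id₁ ⊕ (id₁ ⊕ join y)) ◅ (σ ⊕ idn _) ◅ (id₁ ⊕ join x) ◅ []
    ≈⟨ inside (_ ◅ _ ◅ _ ◅ []) (join-suc x) ⟨
  (σ ⊕ idn _) ◅ (id₁ ⊕ (σ ⊕ idn _)) ◅ (id₁ ⊕ (id₁ ⊕ join y)) ◅ join (suc x) ◅ []
    ≈⟨ inside (_ ◅ []) (lift-cong (join-suc y)) ⟨
  (σ ⊕ idn _) ◅ (id₁ ⊕ join (suc y)) ◅ join (suc x) ◅ []                                             ∎

μ-join : (y : Fin n) → (μ ⊕ idn n) ◅ join y ◅ [] ≋ (id₁ ⊕ join y) ◅ join y ◅ []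
μ-join {suc n} zero = μ-associative n
μ-join {suc n} (suc y) = begin
  (μ ⊕ idn (suc n)) ◅ join (suc y) ◅ []
    ≈⟨ inside (_ ◅ []) (join-suc y) ⟩
  (μ ⊕ idn _) ◅ (σ ⊕ idn _) ◅ (id₁ ⊕ join y) ◅ []
    ≈⟨ inside [] (μ-slide _) ⟩
  (id₁ ⊕ (σ ⊕ idn _)) ◅ (σ ⊕ idn _) ◅ (id₁ ⊕ (μ ⊕ idn _)) ◅ (id₁ ⊕ join y) ◅ []
    ≈⟨ inside (_ ◅ _ ◅ []) (lift-cong (μ-join y)) ⟩
  (id₁ ⊕ (σ ⊕ idn _)) ◅ (σ ⊕ idn _) ◅ (id₁ ⊕ (id₁ ⊕ join y)) ◅ (id₁ ⊕ join y) ◅ []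
    ≈⟨ inside (_ ◅ []) (slide σ (join y)) ⟩
  (id₁ ⊕ (σ ⊕ idn _)) ◅ (id₁ ⊕ (id₁ ⊕ join y)) ◅ (σ ⊕ idn _) ◅ (id₁ ⊕ join y) ◅ []
    ≈⟨ inside (_ ◅ _ ◅ []) (join-suc y) ⟨
  (id₁ ⊕ (σ ⊕ idn _)) ◅ (id₁ ⊕ (id₁ ⊕ join y)) ◅ join (suc y) ◅ []
    ≈⟨ inside [] (lift-cong (join-suc y)) ⟨
  (id₁ ⊕ join (suc y)) ◅ join (suc y) ◅ []                                                   ∎

η-join : (y : Fin n) → (η ⊕ idn n) ◅ join y ◅ [] ≋ []
η-join {suc n} zero = μ-unital n
η-join {suc n} (suc y) = begin
  (η ⊕ idn (suc n)) ◅ join (suc y) ◅ []            ≈⟨ inside (_ ◅ []) (join-suc y) ⟩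
  (η ⊕ idn _) ◅ (σ ⊕ idn _) ◅ (id₁ ⊕ join y) ◅ []  ≈⟨ inside [] (η-slide _) ⟩
  (id₁ ⊕ (η ⊕ idn _)) ◅ (id₁ ⊕ join y) ◅ []        ≈⟨ lift-cong (η-join y) ⟩
  []                                               ∎

δ-join : (y : Fin n) → (δ ⊕ idn n) ◅ (id₁ ⊕ join y) ◅ [] ≋ join y ◅ split y ◅ []
δ-join {suc n} zero = frobenius n
δ-join {suc n} (suc y) = begin
  (δ ⊕ idn (suc n)) ◅ (id₁ ⊕ join (suc y)) ◅ []
    ≈⟨ inside (_ ◅ []) (lift-cong (join-suc y)) ⟩
  (δ ⊕ idn _) ◅ (id₁ ⊕ (σ ⊕ idn _)) ◅ (id₁ ⊕ (id₁ ⊕ join y)) ◅ []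
    ≈⟨ inside [] (δ-slide _) ⟩
  (σ ⊕ idn _) ◅ (id₁ ⊕ (δ ⊕ idn _)) ◅ (σ ⊕ idn _) ◅ (id₁ ⊕ (id₁ ⊕ join y)) ◅ []
    ≈⟨ inside (_ ◅ _ ◅ []) (slide σ (join y)) ⟩
  (σ ⊕ idn _) ◅ (id₁ ⊕ (δ ⊕ idn _)) ◅ (id₁ ⊕ (id₁ ⊕ join y)) ◅ (σ ⊕ idn _) ◅ []
    ≈⟨ inside (_ ◅ []) (lift-cong (δ-join y)) ⟩
  (σ ⊕ idn _) ◅ (id₁ ⊕ join y) ◅ (id₁ ⊕ split y) ◅ (σ ⊕ idn _) ◅ []
    ≈⟨ inside [] (join-suc y) ⟨
  join (suc y) ◅ (id₁ ⊕ split y) ◅ (σ ⊕ idn _) ◅ []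
    ≈⟨ inside (_ ◅ []) (split-suc y) ⟨
  join (suc y) ◅ split (suc y) ◅ []                                                  ∎

-- When both operations concern the first wire this is `frobenius-σ`; when exactly one does, it is
-- naturality of the symmetry. In the remaining case Yang-Baxter gives access to the induction
-- hypothesis.
split-σ-join : (x y : Fin n) →
  (id₁ ⊕ split y) ◅ (σ ⊕ idn n) ◅ (id₁ ⊕ join x) ◅ [] ≋ join x ◅ split y ◅ []
split-σ-join {suc n} zero zero = frobenius-σ n
split-σ-join {suc (suc n)} zero (suc y) = begin
  (id₁ ⊕ split (suc y)) ◅ (σ ⊕ idn _) ◅ (id₁ ⊕ (μ ⊕ idn _)) ◅ []
    ≈⟨ inside [] (lift-cong (split-suc y)) ⟩
  (id₁ ⊕ (id₁ ⊕ split y)) ◅ (id₁ ⊕ (σ ⊕ idn _)) ◅ (σ ⊕ idn _) ◅ (id₁ ⊕ (μ ⊕ idn _)) ◅ []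
    ≈⟨ inside (_ ◅ []) (μ-slide _) ⟨
  (id₁ ⊕ (id₁ ⊕ split y)) ◅ (μ ⊕ idn _) ◅ (σ ⊕ idn _) ◅ []
    ≈⟨ inside [] (slide μ (split y)) ⟨
  (μ ⊕ idn _) ◅ (id₁ ⊕ split y) ◅ (σ ⊕ idn _) ◅ []
    ≈⟨ inside (_ ◅ []) (split-suc y) ⟨
  (μ ⊕ idn _) ◅ split (suc y) ◅ []                                                   ∎
split-σ-join {suc (suc n)} (suc x) zero = begin
  (id₁ ⊕ (δ ⊕ idn _)) ◅ (σ ⊕ idn _) ◅ (id₁ ⊕ join (suc x)) ◅ []
    ≈⟨ inside (_ ◅ _ ◅ []) (lift-cong (join-suc x)) ⟩
  (id₁ ⊕ (δ ⊕ idn _)) ◅ (σ ⊕ idn _) ◅ (id₁ ⊕ (σ ⊕ idn _)) ◅ (id₁ ⊕ (id₁ ⊕ join x)) ◅ []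
    ≈⟨ inside [] (σ-inverse _) ⟨
  (σ ⊕ idn _) ◅ (σ ⊕ idn _) ◅ (id₁ ⊕ (δ ⊕ idn _)) ◅ (σ ⊕ idn _) ◅ (id₁ ⊕ (σ ⊕ idn _)) ◅ (id₁ ⊕ (id₁ ⊕ join x)) ◅ []
    ≈⟨ inside (_ ◅ []) (δ-slide _) ⟨
  (σ ⊕ idn _) ◅ (δ ⊕ idn _) ◅ (id₁ ⊕ (σ ⊕ idn _)) ◅ (id₁ ⊕ (σ ⊕ idn _)) ◅ (id₁ ⊕ (id₁ ⊕ join x)) ◅ []
    ≈⟨ inside (_ ◅ _ ◅ []) (lift-cong (σ-inverse _)) ⟩
  (σ ⊕ idn _) ◅ (δ ⊕ idn _) ◅ (id₁ ⊕ (id₁ ⊕ join x)) ◅ []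
    ≈⟨ inside (_ ◅ []) (slide δ (join x)) ⟩
  (σ ⊕ idn _) ◅ (id₁ ⊕ join x) ◅ (δ ⊕ idn _) ◅ []
    ≈⟨ inside [] (join-suc x) ⟨
  join (suc x) ◅ (δ ⊕ idn _) ◅ []                                                                    ∎
split-σ-join {suc (suc n)} (suc x) (suc y) = begin
  (id₁ ⊕ split (suc y)) ◅ (σ ⊕ idn _) ◅ (id₁ ⊕ join (suc x)) ◅ []
    ≈⟨ inside [] (lift-cong (split-suc y)) ⟩
  (id₁ ⊕ (id₁ ⊕ split y)) ◅ (id₁ ⊕ (σ ⊕ idn _)) ◅ (σ ⊕ idn _) ◅ (id₁ ⊕ join (suc x)) ◅ []
    ≈⟨ inside (_ ◅ _ ◅ _ ◅ []) (lift-cong (join-suc x)) ⟩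
  (id₁ ⊕ (id₁ ⊕ split y)) ◅ (id₁ ⊕ (σ ⊕ idn _)) ◅ (σ ⊕ idn _) ◅ (id₁ ⊕ (σ ⊕ idn _)) ◅ (id₁ ⊕ (id₁ ⊕ join x)) ◅ []
    ≈⟨ inside (_ ◅ []) (σ-braid _) ⟨
  (id₁ ⊕ (id₁ ⊕ split y)) ◅ (σ ⊕ idn _) ◅ (id₁ ⊕ (σ ⊕ idn _)) ◅ (σ ⊕ idn _) ◅ (id₁ ⊕ (id₁ ⊕ join x)) ◅ []
    ≈⟨ inside [] (slide σ (split y)) ⟨
  (σ ⊕ idn _) ◅ (id₁ ⊕ (id₁ ⊕ split y)) ◅ (id₁ ⊕ (σ ⊕ idn _)) ◅ (σ ⊕ idn _) ◅ (id₁ ⊕ (id₁ ⊕ join x)) ◅ []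
    ≈⟨ inside (_ ◅ _ ◅ _ ◅ []) (slide σ (join x)) ⟩
  (σ ⊕ idn _) ◅ (id₁ ⊕ (id₁ ⊕ split y)) ◅ (id₁ ⊕ (σ ⊕ idn _)) ◅ (id₁ ⊕ (id₁ ⊕ join x)) ◅ (σ ⊕ idn _) ◅ []
    ≈⟨ inside (_ ◅ []) (lift-cong (split-σ-join x y)) ⟩
  (σ ⊕ idn _) ◅ (id₁ ⊕ join x) ◅ (id₁ ⊕ split y) ◅ (σ ⊕ idn _) ◅ []
    ≈⟨ inside [] (join-suc x) ⟨
  join (suc x) ◅ (id₁ ⊕ split y) ◅ (σ ⊕ idn _) ◅ []
    ≈⟨ inside (_ ◅ []) (split-suc y) ⟨
  join (suc x) ◅ split (suc y) ◅ []                                                   ∎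

-- Terms of functions

ηs : ∀ n → Term 0 n
ηs zero = id₀
ηs (suc n) = η ⊕ ηs n

func : (Fin n → Fin m) → Term n m
func {zero} f = ηs _
func {suc n} f = (id₁ ⊕ func (f ∘ suc)) ⨾ join (f zero)

func-suc-domain : (f : Fin (suc n) → Fin m) →
                  func f ◅ [] ≋ (id₁ ⊕ func (f ∘ suc)) ◅ join (f zero) ◅ []
func-suc-domain f = ≋-sym (compose _ _)

func-cong : {f g : Fin n → Fin m} → f ≗ g → func f ≈ func g
func-cong {zero} f≗g = ≈-refl
func-cong {suc n} f≗g =
  ⨾-cong (⊕-cong ≈-refl (func-cong (f≗g ∘ suc))) (≈-reflexive (cong join (f≗g zero)))

η⊕ˡ : (t : Term n m) → η ⊕ t ◅ [] ≋ (η ⊕ idn n) ◅ (id₁ ⊕ t) ◅ []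
η⊕ˡ {n} t = begin
  η ⊕ t ◅ []
    ≈⟨ single (⊕-cong (≈-trans (⨾-cong ≈-refl (≈-sym ⊕-id-id₁)) (⨾-idʳ η)) (⨾-idˡ t)) ⟨
  (η ⨾ id₁) ⊕ (idn n ⨾ t) ◅ []     ≈⟨ single (interchange _ _ _ _) ⟩
  (η ⊕ idn n) ⨾ (id₁ ⊕ t) ◅ []     ≈⟨ compose _ _ ⟨
  (η ⊕ idn n) ◅ (id₁ ⊕ t) ◅ []     ∎

η⊕ʳ : (t : Term n m) → η ⊕ t ◅ [] ≋ t ◅ (η ⊕ idn m) ◅ []
η⊕ʳ t = ≋-trans (η⊕ˡ t) (slide η t)

ηs-func : (f : Fin n → Fin m) → ηs n ◅ func f ◅ [] ≋ ηs m ◅ []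
ηs-func {zero} f = ⟪ ⨾-idˡ _ ⟫
ηs-func {suc n} {m} f = begin
  ηs (suc n) ◅ func f ◅ []                                        ≈⟨ inside (_ ◅ []) (func-suc-domain f) ⟩
  η ⊕ ηs n ◅ (id₁ ⊕ func (f ∘ suc)) ◅ join (f zero) ◅ []          ≈⟨ inside [] (η⊕ˡ (ηs n)) ⟩
  (η ⊕ id₀) ◅ (id₁ ⊕ ηs n) ◅ (id₁ ⊕ func (f ∘ suc)) ◅ join (f zero) ◅ []
    ≈⟨ inside (_ ◅ []) (lift-cong (ηs-func (f ∘ suc))) ⟩
  (η ⊕ id₀) ◅ (id₁ ⊕ ηs m) ◅ join (f zero) ◅ []                   ≈⟨ inside [] (slide η (ηs m)) ⟩
  ηs m ◅ (η ⊕ idn m) ◅ join (f zero) ◅ []                         ≈⟨ inside (_ ◅ []) (η-join (f zero)) ⟩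
  ηs m ◅ []                                                       ∎

-- A wire that joins wire `suc x` has to reach `f (suc x)` in spite of the later join at `f zero`;
-- `join-join` lets the two joins change places.
join-func : (x : Fin n) (f : Fin n → Fin m) →
            join x ◅ func f ◅ [] ≋ (id₁ ⊕ func f) ◅ join (f x) ◅ []
join-func {suc n} zero f = begin
  (μ ⊕ idn n) ◅ func f ◅ []
    ≈⟨ inside (_ ◅ []) (func-suc-domain f) ⟩
  (μ ⊕ idn n) ◅ (id₁ ⊕ func (f ∘ suc)) ◅ join (f zero) ◅ []
    ≈⟨ inside [] (slide μ (func (f ∘ suc))) ⟩
  (id₁ ⊕ (id₁ ⊕ func (f ∘ suc))) ◅ (μ ⊕ idn _) ◅ join (f zero) ◅ []
    ≈⟨ inside (_ ◅ []) (μ-join (f zero)) ⟩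
  (id₁ ⊕ (id₁ ⊕ func (f ∘ suc))) ◅ (id₁ ⊕ join (f zero)) ◅ join (f zero) ◅ []
    ≈⟨ inside [] (lift-cong (func-suc-domain f)) ⟨
  (id₁ ⊕ func f) ◅ join (f zero) ◅ []                                        ∎
join-func {suc n} (suc x) f = begin
  join (suc x) ◅ func f ◅ []                                                 ≈⟨ inside [] (join-suc x) ⟩
  (σ ⊕ idn n) ◅ (id₁ ⊕ join x) ◅ func f ◅ []
    ≈⟨ inside (_ ◅ _ ◅ []) (func-suc-domain f) ⟩
  (σ ⊕ idn n) ◅ (id₁ ⊕ join x) ◅ (id₁ ⊕ func (f ∘ suc)) ◅ join (f zero) ◅ []
    ≈⟨ inside (_ ◅ []) (lift-cong (join-func x (f ∘ suc))) ⟩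
  (σ ⊕ idn n) ◅ (id₁ ⊕ (id₁ ⊕ func (f ∘ suc))) ◅ (id₁ ⊕ join (f (suc x))) ◅ join (f zero) ◅ []
    ≈⟨ inside [] (slide σ (func (f ∘ suc))) ⟩
  (id₁ ⊕ (id₁ ⊕ func (f ∘ suc))) ◅ (σ ⊕ idn _) ◅ (id₁ ⊕ join (f (suc x))) ◅ join (f zero) ◅ []
    ≈⟨ inside (_ ◅ []) (join-join (f zero) (f (suc x))) ⟨
  (id₁ ⊕ (id₁ ⊕ func (f ∘ suc))) ◅ (id₁ ⊕ join (f zero)) ◅ join (f (suc x)) ◅ []
    ≈⟨ inside [] (lift-cong (func-suc-domain f)) ⟨
  (id₁ ⊕ func f) ◅ join (f (suc x)) ◅ []                                     ∎

func-∘ : (g : Fin n → Fin m) (f : Fin m → Fin p) → func g ◅ func f ◅ [] ≋ func (f ∘ g) ◅ []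
func-∘ {zero} g f = ηs-func f
func-∘ {suc n} g f = begin
  func g ◅ func f ◅ []                                                ≈⟨ inside [] (func-suc-domain g) ⟩
  (id₁ ⊕ func (g ∘ suc)) ◅ join (g zero) ◅ func f ◅ []
    ≈⟨ inside (_ ◅ []) (join-func (g zero) f) ⟩
  (id₁ ⊕ func (g ∘ suc)) ◅ (id₁ ⊕ func f) ◅ join (f (g zero)) ◅ []
    ≈⟨ inside [] (lift-cong (func-∘ (g ∘ suc) f)) ⟩
  (id₁ ⊕ func (f ∘ g ∘ suc)) ◅ join (f (g zero)) ◅ []                 ≈⟨ func-suc-domain (f ∘ g) ⟨
  func (f ∘ g) ◅ []                                                   ∎

func-suc : (f : Fin n → Fin m) → func (suc ∘ f) ≈ η ⊕ func f
func-suc {zero} f = ≈-refl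
func-suc {suc n} {m} f = unsingle (begin
  func (suc ∘ f) ◅ []                                                          ≈⟨ func-suc-domain (suc ∘ f) ⟩
  (id₁ ⊕ func (suc ∘ f ∘ suc)) ◅ join (suc (f zero)) ◅ []
    ≈⟨ inside [] (lift-cong (≋-trans (single (func-suc (f ∘ suc))) (η⊕ʳ _))) ⟩
  (id₁ ⊕ func (f ∘ suc)) ◅ (id₁ ⊕ (η ⊕ idn m)) ◅ join (suc (f zero)) ◅ []
    ≈⟨ inside (_ ◅ _ ◅ []) (join-suc (f zero)) ⟩
  (id₁ ⊕ func (f ∘ suc)) ◅ (id₁ ⊕ (η ⊕ idn m)) ◅ (σ ⊕ idn m) ◅ (id₁ ⊕ join (f zero)) ◅ []
    ≈⟨ inside (_ ◅ []) (η-slide m) ⟨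
  (id₁ ⊕ func (f ∘ suc)) ◅ (η ⊕ idn _) ◅ (σ ⊕ idn m) ◅ (σ ⊕ idn m) ◅ (id₁ ⊕ join (f zero)) ◅ []
    ≈⟨ inside (_ ◅ _ ◅ []) (σ-inverse m) ⟩
  (id₁ ⊕ func (f ∘ suc)) ◅ (η ⊕ idn _) ◅ (id₁ ⊕ join (f zero)) ◅ []
    ≈⟨ inside (_ ◅ []) (slide η (join (f zero))) ⟩
  (id₁ ⊕ func (f ∘ suc)) ◅ join (f zero) ◅ (η ⊕ idn m) ◅ []
    ≈⟨ inside [] (func-suc-domain f) ⟨
  func f ◅ (η ⊕ idn m) ◅ []                                                    ≈⟨ η⊕ʳ (func f) ⟨
  η ⊕ func f ◅ []                                                              ∎)

μ-unitalʳ : ∀ n → (id₁ ⊕ (η ⊕ idn n)) ◅ (μ ⊕ idn n) ◅ [] ≋ []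
μ-unitalʳ n = begin
  (id₁ ⊕ (η ⊕ idn n)) ◅ (μ ⊕ idn n) ◅ []                ≈⟨ inside [] (η-slide n) ⟨
  (η ⊕ idn (suc n)) ◅ (σ ⊕ idn n) ◅ (μ ⊕ idn n) ◅ []    ≈⟨ inside (_ ◅ []) (μ-commutative n) ⟩
  (η ⊕ idn (suc n)) ◅ (μ ⊕ idn n) ◅ []                  ≈⟨ μ-unital n ⟩
  []                                                    ∎

-- Only pointwise equality is asked of `g`, so that the lemma applies to `id`, `_↑ˡ b` and
-- `punchIn (suc x)`, none of which is literally a `liftF 1`.
func-lift : (f : Fin n → Fin m) (g : Fin (suc n) → Fin (suc m)) → g ≗ liftF 1 f → func g ≈ id₁ ⊕ func f
func-lift {n} {m} f g g≗lift = unsingle (begin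
  func g ◅ []                                              ≈⟨ single (func-cong g≗lift) ⟩
  func (liftF 1 f) ◅ []                                    ≈⟨ func-suc-domain (liftF 1 f) ⟩
  (id₁ ⊕ func (suc ∘ f)) ◅ (μ ⊕ idn m) ◅ []
    ≈⟨ inside [] (lift-cong (≋-trans (single (func-suc f)) (η⊕ʳ _))) ⟩
  (id₁ ⊕ func f) ◅ (id₁ ⊕ (η ⊕ idn m)) ◅ (μ ⊕ idn m) ◅ []  ≈⟨ inside (_ ◅ []) (μ-unitalʳ m) ⟩
  id₁ ⊕ func f ◅ []                                        ∎)

func-id : ∀ n → func (id {A = Fin n}) ≈ idn n
func-id zero = ≈-refl
func-id (suc n) = ≈-trans (func-lift id id λ { zero → refl ; (suc i) → refl }) (⊕-cong ≈-refl (func-id n))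

join-⊕ : (x : Fin n) → join x ⊕ idn m ≈ join (x ↑ˡ m)
join-⊕ {suc n} {m} zero = ≈-trans (⊕-assoc μ (idn n) (idn m)) (⊕-cong ≈-refl (⊕-id n m))
join-⊕ {suc n} {m} (suc x) = ≈-trans (⊕-⨾ˡ _ _) (⨾-cong
  (≈-trans (⊕-assoc σ (idn n) (idn m)) (⊕-cong ≈-refl (⊕-id n m)))
  (≈-trans (⊕-assoc id₁ (join x) (idn m)) (⊕-cong ≈-refl (join-⊕ x))))

ηs-⊕-func : ∀ a (g : Fin n → Fin m) → ηs a ⊕ func g ≈ func (λ j → a ↑ʳ g j)
ηs-⊕-func zero g = ⊕-unitˡ _
ηs-⊕-func (suc a) g = ≈-trans (⊕-assoc η (ηs a) (func g))
  (≈-trans (⊕-cong ≈-refl (ηs-⊕-func a g)) (≈-sym (func-suc _)))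

func-⊕ : (f : Fin n → Fin m) (g : Fin p → Fin q) → func f ⊕ func g ≈ func (f +F g)
func-⊕ {zero} f g = ηs-⊕-func _ g
func-⊕ {suc n} {m} {p} {q} f g = unsingle (begin
  func f ⊕ func g ◅ []                                              ≈⟨ single (⊕-cong ≈-refl (⨾-idʳ _)) ⟨
  func f ⊕ (func g ⨾ idn q) ◅ []                                    ≈⟨ single (interchange _ _ _ _) ⟩
  ((id₁ ⊕ func (f ∘ suc)) ⊕ func g) ⨾ (join (f zero) ⊕ idn q) ◅ []
    ≈⟨ single (⨾-cong (⊕-assoc id₁ _ _) (join-⊕ (f zero))) ⟩
  (id₁ ⊕ (func (f ∘ suc) ⊕ func g)) ⨾ join (f zero ↑ˡ q) ◅ []
    ≈⟨ single (⨾-cong (⊕-cong ≈-refl tail) ≈-refl) ⟩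
  func (f +F g) ◅ []                                                ∎)
  where
  tail : func (f ∘ suc) ⊕ func g ≈ func ((f +F g) ∘ suc)
  tail = ≈-trans (func-⊕ (f ∘ suc) g) (func-cong (≡.sym ∘ +F-suc f g))

-- The Frobenius laws for a whole function: `δ-join` and `split-σ-join` carry a branching past every
-- `join` of which `func f` is built. With its mirror image `func-join` it drives the induction step
-- of `func-pushout`.
split-func : (x : Fin n) (f : Fin n → Fin m) →
             split x ◅ (id₁ ⊕ func f) ◅ [] ≋ func f ◅ split (f x) ◅ []
split-func {suc n} {m} zero f = begin
  (δ ⊕ idn n) ◅ (id₁ ⊕ func f) ◅ []
    ≈⟨ inside (_ ◅ []) (lift-cong (func-suc-domain f)) ⟩
  (δ ⊕ idn n) ◅ (id₁ ⊕ (id₁ ⊕ func (f ∘ suc))) ◅ (id₁ ⊕ join (f zero)) ◅ []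
    ≈⟨ inside [] (slide δ (func (f ∘ suc))) ⟩
  (id₁ ⊕ func (f ∘ suc)) ◅ (δ ⊕ idn m) ◅ (id₁ ⊕ join (f zero)) ◅ []
    ≈⟨ inside (_ ◅ []) (δ-join (f zero)) ⟩
  (id₁ ⊕ func (f ∘ suc)) ◅ join (f zero) ◅ split (f zero) ◅ []
    ≈⟨ inside [] (func-suc-domain f) ⟨
  func f ◅ split (f zero) ◅ []                                                   ∎
split-func {suc n} {m} (suc x) f = begin
  split (suc x) ◅ (id₁ ⊕ func f) ◅ []                                            ≈⟨ inside [] (split-suc x) ⟩
  (id₁ ⊕ split x) ◅ (σ ⊕ idn n) ◅ (id₁ ⊕ func f) ◅ []
    ≈⟨ inside (_ ◅ _ ◅ []) (lift-cong (func-suc-domain f)) ⟩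
  (id₁ ⊕ split x) ◅ (σ ⊕ idn n) ◅ (id₁ ⊕ (id₁ ⊕ func (f ∘ suc))) ◅ (id₁ ⊕ join (f zero)) ◅ []
    ≈⟨ inside (_ ◅ []) (slide σ (func (f ∘ suc))) ⟩
  (id₁ ⊕ split x) ◅ (id₁ ⊕ (id₁ ⊕ func (f ∘ suc))) ◅ (σ ⊕ idn m) ◅ (id₁ ⊕ join (f zero)) ◅ []
    ≈⟨ inside [] (lift-cong (split-func x (f ∘ suc))) ⟩
  (id₁ ⊕ func (f ∘ suc)) ◅ (id₁ ⊕ split (f (suc x))) ◅ (σ ⊕ idn m) ◅ (id₁ ⊕ join (f zero)) ◅ []
    ≈⟨ inside (_ ◅ []) (split-σ-join (f zero) (f (suc x))) ⟩
  (id₁ ⊕ func (f ∘ suc)) ◅ join (f zero) ◅ split (f (suc x)) ◅ []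
    ≈⟨ inside [] (func-suc-domain f) ⟨
  func f ◅ split (f (suc x)) ◅ []                                                ∎

func-join : (x : Fin n) (f : Fin n → Fin m) →
            (id₁ ⊕ op (func f)) ◅ join x ◅ [] ≋ join (f x) ◅ op (func f) ◅ []
func-join x f = ≡.subst₂ (λ t u → (id₁ ⊕ op (func f)) ◅ t ◅ [] ≋ u ◅ op (func f) ◅ [])
  (op-split x) (op-split (f x)) (opᴾ-cong (split-func x f))

-- Coequalizers and pushouts of finite sets

collapse : Fin n → Fin (suc n) → Fin n
collapse v zero = v
collapse v (suc w) = w

-- Size of the coequalizer of two points: `n` when they coincide, one less otherwise. Recursion on
-- both points makes it reduce in step with `merge`.
merged : {n : ℕ} (u v : Fin n) → ℕ
merged {suc n} zero zero = suc n
merged {suc n} zero (suc v) = n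
merged {suc n} (suc u) zero = n
merged {suc n} (suc u) (suc v) = suc (merged u v)

merge : (u v : Fin n) → Fin n → Fin (merged u v)
merge {suc n} zero zero = id
merge {suc n} zero (suc v) = collapse v
merge {suc n} (suc u) zero = collapse u
merge {suc n} (suc u) (suc v) = liftF 1 (merge u v)

func-collapse : (v : Fin n) → func (collapse v) ≈ join v
func-collapse {n} v = ≈-trans (⨾-cong (⊕-cong ≈-refl (func-id n)) ≈-refl) (⨾-idˡ _)

op-func-collapse : (v : Fin n) → op (func (collapse v)) ≈ split v
op-func-collapse v = ≈-trans (op-resp-≈ (func-collapse v)) (≈-reflexive (op-join v))

-- Cocommutativity removes the crossing in `join (suc v)`, which leaves the Frobenius law `δ-join`.
δ-suc-join : (v : Fin n) → (δ ⊕ idn n) ◅ join (suc v) ◅ [] ≋ join v ◅ split v ◅ []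
δ-suc-join {n} v = begin
  (δ ⊕ idn n) ◅ join (suc v) ◅ []                     ≈⟨ inside (_ ◅ []) (join-suc v) ⟩
  (δ ⊕ idn n) ◅ (σ ⊕ idn n) ◅ (id₁ ⊕ join v) ◅ []
    ≈⟨ inside [] (pad-cong n (≋-trans (compose δ σ) (single δ-comm))) ⟩
  (δ ⊕ idn n) ◅ (id₁ ⊕ join v) ◅ []                   ≈⟨ δ-join v ⟩
  join v ◅ split v ◅ []                               ∎

-- A copy of wire `u` that runs into wire `v` connects the two, as does gluing them and branching
-- again. On a single wire the copy forms a loop, which the special law removes.
split-join : (u v : Fin n) → split u ◅ join v ◅ [] ≋ func (merge u v) ◅ op (func (merge u v)) ◅ []
split-join {suc n} zero zero = begin
  (δ ⊕ idn n) ◅ (μ ⊕ idn n) ◅ []  ≈⟨ μ-special n ⟩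
  []
    ≈⟨ ≋-trans (compose _ _) (erase (≈-trans (⨾-cong func-id′ (op-resp-≈ func-id′)) (unitary-idn (suc n)))) ⟨
  func id ◅ op (func id) ◅ []     ∎
  where func-id′ = func-id (suc n)
split-join {suc n} zero (suc v) = begin
  (δ ⊕ idn n) ◅ join (suc v) ◅ []                        ≈⟨ δ-suc-join v ⟩
  join v ◅ split v ◅ []
    ≈⟨ ◅◅-cong (single (func-collapse v)) (single (op-func-collapse v)) ⟨
  func (collapse v) ◅ op (func (collapse v)) ◅ []        ∎
split-join {suc n} (suc u) zero = begin
  split (suc u) ◅ (μ ⊕ idn n) ◅ []
    ≡⟨ cong₂ (λ t i → t ◅ (μ ⊕ i) ◅ []) (op-join (suc u)) (op-idn n) ⟨
  op (join (suc u)) ◅ (μ ⊕ op (idn n)) ◅ []              ≈⟨ opᴾ-cong (δ-suc-join u) ⟩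
  op (split u) ◅ op (join u) ◅ []
    ≡⟨ cong₂ (λ t t′ → t ◅ t′ ◅ []) (op-split u) (op-join u) ⟩
  join u ◅ split u ◅ []
    ≈⟨ ◅◅-cong (single (func-collapse u)) (single (op-func-collapse u)) ⟨
  func (collapse u) ◅ op (func (collapse u)) ◅ []        ∎
split-join {suc n} (suc u) (suc v) = begin
  split (suc u) ◅ join (suc v) ◅ []                                            ≈⟨ inside [] (split-suc u) ⟩
  (id₁ ⊕ split u) ◅ (σ ⊕ idn n) ◅ join (suc v) ◅ []
    ≈⟨ inside (_ ◅ _ ◅ []) (join-suc v) ⟩
  (id₁ ⊕ split u) ◅ (σ ⊕ idn n) ◅ (σ ⊕ idn n) ◅ (id₁ ⊕ join v) ◅ []
    ≈⟨ inside (_ ◅ []) (σ-inverse n) ⟩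
  (id₁ ⊕ split u) ◅ (id₁ ⊕ join v) ◅ []                                        ≈⟨ lift-cong (split-join u v) ⟩
  (id₁ ⊕ func (merge u v)) ◅ (id₁ ⊕ op (func (merge u v))) ◅ []
    ≈⟨ ◅◅-cong (single fl) (single (op-resp-≈ fl)) ⟨
  func (liftF 1 (merge u v)) ◅ op (func (liftF 1 (merge u v))) ◅ []            ∎
  where fl = func-lift (merge u v) (liftF 1 (merge u v)) λ _ → refl

pushout : ∀ {z a b} → (Fin z → Fin a) → (Fin z → Fin b) → Cospan a b
pushout {zero} {a} {b} f g = cospan (a + b) (_↑ˡ b) (a ↑ʳ_)
pushout {suc z} {a} {b} f g = cospan (merged (left P u) (right P v)) (e ∘ left P) (e ∘ right P)
  where
  P = pushout (f ∘ suc) (g ∘ suc)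
  u = f zero
  v = g zero
  e = merge (left P u) (right P v)

-- Beck-Chevalley over the empty set, where the pushout is the disjoint sum: `a` wires end and `b`
-- new ones start.
op-ηs-ηs : ∀ a b → op (ηs a) ◅ ηs b ◅ [] ≋ func (_↑ˡ b) ◅ op (func {b} (a ↑ʳ_)) ◅ []
op-ηs-ηs zero b = begin
  id₀ ◅ ηs b ◅ []                              ≈⟨ ⟪ ⨾-idˡ _ ⟫ ⟩
  ηs b ◅ []
    ≈⟨ inside (_ ◅ []) (erase (≈-trans (op-resp-≈ (func-id b)) (≈-reflexive (op-idn b)))) ⟨
  ηs b ◅ op (func id) ◅ []                     ∎
op-ηs-ηs (suc a) b = ≋-sym (begin
  func (_↑ˡ b) ◅ op (func (suc a ↑ʳ_)) ◅ []
    ≈⟨ ◅◅-cong (single ↑ˡ-suc) (single (op-resp-≈ (func-suc (a ↑ʳ_)))) ⟩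
  (id₁ ⊕ func (_↑ˡ b)) ◅ ε ⊕ op (func (a ↑ʳ_)) ◅ []  ≈⟨ compose _ _ ⟩
  (id₁ ⊕ func (_↑ˡ b)) ⨾ (ε ⊕ op (func (a ↑ʳ_))) ◅ []  ≈⟨ single (interchange _ _ _ _) ⟨
  (id₁ ⨾ ε) ⊕ (func (_↑ˡ b) ⨾ op (func (a ↑ʳ_))) ◅ []
    ≈⟨ single (⊕-cong (≈-trans (⨾-cong (≈-sym ⊕-id-id₁) ≈-refl) (≈-trans (⨾-idˡ ε) (≈-sym (⨾-idʳ ε))))
                      (unsingle (≋-trans (≋-sym (compose _ _)) (≋-trans (≋-sym (op-ηs-ηs a b)) (compose _ _))))) ⟩
  (ε ⨾ id₀) ⊕ (op (ηs a) ⨾ ηs b) ◅ []          ≈⟨ single (interchange _ _ _ _) ⟩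
  (ε ⊕ op (ηs a)) ⨾ (id₀ ⊕ ηs b) ◅ []          ≈⟨ compose _ _ ⟨
  op (ηs (suc a)) ◅ (id₀ ⊕ ηs b) ◅ []          ≈⟨ inside (_ ◅ []) (single (⊕-unitˡ (ηs b))) ⟩
  op (ηs (suc a)) ◅ ηs b ◅ []                  ∎)
  where
  ↑ˡ-suc : func (_↑ˡ b) ≈ id₁ ⊕ func (_↑ˡ b)
  ↑ˡ-suc = func-lift (_↑ˡ b) (_↑ˡ b) λ { zero → refl ; (suc i) → refl }

-- The induction hypothesis puts `func i` and `op (func j)`, for the pushout of the remaining
-- points, between the branching at `f zero` and the join at `g zero`. These move inwards until they
-- meet in `split-join`, which performs the last gluing.
func-pushout : (f : Fin z → Fin a) (g : Fin z → Fin b) → let P = pushout f g in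
  op (func f) ◅ func g ◅ [] ≋ func (left P) ◅ op (func (right P)) ◅ []
func-pushout {zero} {a} {b} f g = op-ηs-ηs a b
func-pushout {suc z} {a} {b} f g = begin
  op (func f) ◅ func g ◅ []
    ≈⟨ inside [] (opᴾ-cong (func-suc-domain f)) ⟩
  op (join (f zero)) ◅ (id₁ ⊕ op (func (f ∘ suc))) ◅ func g ◅ []
    ≡⟨ cong (λ t → t ◅ (id₁ ⊕ op (func (f ∘ suc))) ◅ func g ◅ []) (op-join (f zero)) ⟩
  split (f zero) ◅ (id₁ ⊕ op (func (f ∘ suc))) ◅ func g ◅ []
    ≈⟨ inside (_ ◅ _ ◅ []) (func-suc-domain g) ⟩
  split (f zero) ◅ (id₁ ⊕ op (func (f ∘ suc))) ◅ (id₁ ⊕ func (g ∘ suc)) ◅ join (g zero) ◅ []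
    ≈⟨ inside (_ ◅ []) (lift-cong (func-pushout (f ∘ suc) (g ∘ suc))) ⟩
  split (f zero) ◅ (id₁ ⊕ func i) ◅ (id₁ ⊕ op (func j)) ◅ join (g zero) ◅ []
    ≈⟨ inside [] (split-func (f zero) i) ⟩
  func i ◅ split (i (f zero)) ◅ (id₁ ⊕ op (func j)) ◅ join (g zero) ◅ []
    ≈⟨ inside (_ ◅ _ ◅ []) (func-join (g zero) j) ⟩
  func i ◅ split (i (f zero)) ◅ join (j (g zero)) ◅ op (func j) ◅ []
    ≈⟨ inside (_ ◅ []) (split-join (i (f zero)) (j (g zero))) ⟩
  func i ◅ func e ◅ op (func e) ◅ op (func j) ◅ []
    ≈⟨ inside [] (func-∘ i e) ⟩
  func (e ∘ i) ◅ op (func e) ◅ op (func j) ◅ []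
    ≈⟨ inside (_ ◅ []) (opᴾ-cong (func-∘ j e)) ⟩
  func (e ∘ i) ◅ op (func (e ∘ j)) ◅ []                                              ∎
  where
  P = pushout (f ∘ suc) (g ∘ suc)
  i = left P
  j = right P
  e = merge (i (f zero)) (j (g zero))

-- Normal forms

nf : Cospan n m → Term n m
nf c = func (left c) ⨾ op (func (right c))

nf-path : (c : Cospan n m) → nf c ◅ [] ≋ func (left c) ◅ op (func (right c)) ◅ []
nf-path c = ≋-sym (compose _ _)

infixl 5 _⨾C_
_⨾C_ : Cospan n z → Cospan z m → Cospan n m
c ⨾C d = cospan (apex P) (left P ∘ left c) (right P ∘ right d)
  where P = pushout (right c) (left d)

nf-⨾ : (c : Cospan n z) (d : Cospan z m) → nf c ⨾ nf d ≈ nf (c ⨾C d)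
nf-⨾ c d = unsingle (begin
  nf c ⨾ nf d ◅ []                                                                 ≈⟨ compose _ _ ⟨
  nf c ◅ nf d ◅ []
    ≈⟨ ◅◅-cong (nf-path c) (nf-path d) ⟩
  func (left c) ◅ op (func (right c)) ◅ func (left d) ◅ op (func (right d)) ◅ []
    ≈⟨ inside (_ ◅ []) (func-pushout (right c) (left d)) ⟩
  func (left c) ◅ func (left P) ◅ op (func (right P)) ◅ op (func (right d)) ◅ []
    ≈⟨ inside [] (func-∘ (left c) (left P)) ⟩
  func (left P ∘ left c) ◅ op (func (right P)) ◅ op (func (right d)) ◅ []
    ≈⟨ inside (_ ◅ []) (opᴾ-cong (func-∘ (right d) (right P))) ⟩
  func (left P ∘ left c) ◅ op (func (right P ∘ right d)) ◅ []                      ≈⟨ nf-path (c ⨾C d) ⟨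
  nf (c ⨾C d) ◅ []                                                                 ∎)
  where P = pushout (right c) (left d)

nf-⊕ : (c : Cospan n m) (d : Cospan p q) → nf c ⊕ nf d ≈ nf (c ⊕C d)
nf-⊕ c d = ≈-trans (interchange _ _ _ _)
  (⨾-cong (func-⊕ (left c) (left d)) (op-resp-≈ (func-⊕ (right c) (right d))))

func-const : func {2} {1} (λ _ → zero) ≈ μ
func-const = unsingle (begin
  func (λ _ → zero) ◅ []                                     ≈⟨ func-suc-domain {1} (λ _ → zero) ⟩
  (id₁ ⊕ func (λ _ → zero)) ◅ (μ ⊕ id₀) ◅ []
    ≈⟨ inside [] (lift-cong (single (func-cong {f = λ _ → zero} {id} λ { zero → refl }))) ⟩
  (id₁ ⊕ func id) ◅ (μ ⊕ id₀) ◅ []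
    ≈⟨ inside [] (erase (⊕-cong ≈-refl (func-id 1))) ⟩
  (μ ⊕ id₀) ◅ []                                             ≈⟨ single (⊕-unitʳ μ) ⟩
  μ ◅ []                                                     ∎)

func-swap : func swap₂ ≈ σ
func-swap = unsingle (begin
  func swap₂ ◅ []                                                         ≈⟨ func-suc-domain swap₂ ⟩
  (id₁ ⊕ func {1} (λ _ → zero)) ◅ join (suc zero) ◅ []                    ≈⟨ inside (_ ◅ []) (join-suc zero) ⟩
  (id₁ ⊕ func {1} (λ _ → zero)) ◅ (σ ⊕ idn 1) ◅ (id₁ ⊕ (μ ⊕ id₀)) ◅ []
    ≈⟨ inside [] (lift-cong (single inject)) ⟩
  (id₁ ⊕ (id₁ ⊕ (η ⊕ id₀))) ◅ (σ ⊕ idn 1) ◅ (id₁ ⊕ (μ ⊕ id₀)) ◅ []        ≈⟨ inside [] (slide σ (η ⊕ id₀)) ⟨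
  (σ ⊕ id₀) ◅ (id₁ ⊕ (id₁ ⊕ (η ⊕ id₀))) ◅ (id₁ ⊕ (μ ⊕ id₀)) ◅ []
    ≈⟨ inside (_ ◅ []) (lift-cong (μ-unitalʳ 0)) ⟩
  (σ ⊕ id₀) ◅ []                                                          ≈⟨ single (⊕-unitʳ σ) ⟩
  σ ◅ []                                                                  ∎)
  where
  inject : func {1} {2} (λ _ → zero) ≈ id₁ ⊕ (η ⊕ id₀)
  inject = func-lift {0} {1} (λ ()) (λ _ → zero) λ { zero → refl }

-- Invariance of normal forms under isomorphism

-- Moves the first wire to position x.
insert : Fin (suc n) → Term (suc n) (suc n)
insert zero = idn _
insert {suc n} (suc x) = (σ ⊕ idn n) ⨾ (id₁ ⊕ insert x)

unitary-insert : (x : Fin (suc n)) → Unitary (insert x)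
unitary-insert zero = unitary-idn _
unitary-insert {suc n} (suc x) = unitary-⨾ _ _
  (unitary-⊕ _ _ σ⨾σ (unitary-idn n)) (unitary-⊕ _ _ unitary-id₁ (unitary-insert x))

-- `punchIn x` misses exactly `x`, so the extra wire meets only a unit there and is merely moved
-- into place. This splits one wire off a permutation.
punchIn-join : (x : Fin (suc n)) → (id₁ ⊕ func (punchIn x)) ◅ join x ◅ [] ≋ insert x ◅ []
punchIn-join {n} zero = begin
  (id₁ ⊕ func suc) ◅ (μ ⊕ idn n) ◅ []  ≈⟨ func-suc-domain {n} id ⟨
  func id ◅ []                         ≈⟨ single (func-id (suc n)) ⟩
  idn (suc n) ◅ []                     ∎
punchIn-join {suc n} (suc x) = begin
  (id₁ ⊕ func (punchIn (suc x))) ◅ join (suc x) ◅ []                     ≈⟨ inside (_ ◅ []) (join-suc x) ⟩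
  (id₁ ⊕ func (punchIn (suc x))) ◅ (σ ⊕ idn _) ◅ (id₁ ⊕ join x) ◅ []
    ≈⟨ inside [] (lift-cong (single punchIn-suc)) ⟩
  (id₁ ⊕ (id₁ ⊕ func (punchIn x))) ◅ (σ ⊕ idn _) ◅ (id₁ ⊕ join x) ◅ []
    ≈⟨ inside [] (slide σ (func (punchIn x))) ⟨
  (σ ⊕ idn n) ◅ (id₁ ⊕ (id₁ ⊕ func (punchIn x))) ◅ (id₁ ⊕ join x) ◅ []
    ≈⟨ inside (_ ◅ []) (lift-cong (punchIn-join x)) ⟩
  (σ ⊕ idn n) ◅ (id₁ ⊕ insert x) ◅ []                                    ≈⟨ compose _ _ ⟩
  insert (suc x) ◅ []                                                    ∎
  where
  punchIn-suc : func (punchIn (suc x)) ≈ id₁ ⊕ func (punchIn x)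
  punchIn-suc = func-lift (punchIn x) (punchIn (suc x)) λ { zero → refl ; (suc i) → refl }

unitary-resp-≈ : {t u : Term n m} → t ≈ u → Unitary u → Unitary t
unitary-resp-≈ t≈u Uu = ≈-trans (⨾-cong t≈u (op-resp-≈ t≈u)) Uu

-- Splitting off the first wire leaves a smaller permutation followed by an `insert`. For a general
-- function only the inequality `func-counit` is available.
unitary-permutation : (π : Permutation n m) → Unitary (func (π ⟨$⟩ʳ_))
unitary-permutation {zero} {zero} π = unitary-idn 0
unitary-permutation {zero} {suc m} π with () ← Inverse.from π zero
unitary-permutation {suc n} {zero} π with () ← Inverse.to π zero
unitary-permutation {suc n} {suc m} π = unitary-resp-≈ factor
  (unitary-⨾ _ _ (unitary-⊕ _ _ unitary-id₁ (unitary-permutation (remove zero π))) (unitary-insert x))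
  where
  x = π ⟨$⟩ʳ zero
  factor : func (π ⟨$⟩ʳ_) ≈ (id₁ ⊕ func (remove zero π ⟨$⟩ʳ_)) ⨾ insert x
  factor = unsingle (begin
    func (π ⟨$⟩ʳ_) ◅ []                                                       ≈⟨ func-suc-domain (π ⟨$⟩ʳ_) ⟩
    (id₁ ⊕ func ((π ⟨$⟩ʳ_) ∘ suc)) ◅ join x ◅ []
      ≈⟨ inside [] (lift-cong (≋-trans (single (func-cong (punchIn-permute π zero))) (≋-sym (func-∘ _ (punchIn x))))) ⟩
    (id₁ ⊕ func (remove zero π ⟨$⟩ʳ_)) ◅ (id₁ ⊕ func (punchIn x)) ◅ join x ◅ []
      ≈⟨ inside (_ ◅ []) (punchIn-join x) ⟩
    (id₁ ⊕ func (remove zero π ⟨$⟩ʳ_)) ◅ insert x ◅ []                        ≈⟨ compose _ _ ⟩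
    (id₁ ⊕ func (remove zero π ⟨$⟩ʳ_)) ⨾ insert x ◅ []                        ∎)

nf-cong : {c d : Cospan n m} → c ≅ d → nf c ≈ nf d
nf-cong {c = c} {d} c≅d = unsingle (begin
  nf c ◅ []                                                          ≈⟨ nf-path c ⟩
  func (left c) ◅ op (func (right c)) ◅ []
    -- The relabelling and its reverse are inserted between the two halves, and each half absorbs
    -- one of them.
    ≈⟨ inside (_ ◅ []) (≋-trans (compose _ _) (erase (unitary-permutation iso))) ⟨
  func (left c) ◅ func φ ◅ op (func φ) ◅ op (func (right c)) ◅ []    ≈⟨ inside [] (func-∘ (left c) φ) ⟩
  func (φ ∘ left c) ◅ op (func φ) ◅ op (func (right c)) ◅ []
    ≈⟨ inside (_ ◅ []) (opᴾ-cong (func-∘ (right c) φ)) ⟩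
  func (φ ∘ left c) ◅ op (func (φ ∘ right c)) ◅ []
    ≈⟨ ◅◅-cong (single (func-cong commˡ)) (single (op-resp-≈ (func-cong commʳ))) ⟩
  func (left d) ◅ op (func (right d)) ◅ []                           ≈⟨ nf-path d ⟨
  nf d ◅ []                                                          ∎)
  where
  open _≅_ c≅d
  φ = Inverse.to iso

-- Monotonicity of normal forms

≤-refl : {t : Term n m} → t ≤ t
≤-refl = ≤-≈ ≈-refl

cancel : (t : Term n m) (u : Term m n) → t ⨾ u ≤ idn n →
         {s : Term p n} {v : Term n q} → s ⨾ t ⨾ (u ⨾ v) ≤ s ⨾ v
cancel t u tu≤id {s} {v} = ≤-trans (≤-≈ regroup) (≤-trans (⨾-mono ≤-refl (⨾-mono tu≤id ≤-refl)) (≤-≈ (⨾-cong ≈-refl (⨾-idˡ v))))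
  where
  regroup : s ⨾ t ⨾ (u ⨾ v) ≈ s ⨾ (t ⨾ u ⨾ v)
  regroup = ≈-trans (⨾-assoc s t _) (⨾-cong ≈-refl (≈-sym (⨾-assoc t u v)))

ηs-counit : ∀ n → ηs n ⨾ op (ηs n) ≤ id₀
ηs-counit zero = ≤-≈ (⨾-idˡ id₀)
ηs-counit (suc n) = ≤-trans (≤-≈ (≈-sym (interchange _ _ _ _)))
  (≤-trans (⊕-mono ax₂ (ηs-counit n)) (≤-≈ (⊕-unitˡ id₀)))

id₁⊕-≤-idn : (t : Term n m) (u : Term m n) → t ⨾ u ≤ idn n → (id₁ ⊕ t) ⨾ (id₁ ⊕ u) ≤ idn (suc n)
id₁⊕-≤-idn t u tu≤id = ≤-trans (≤-≈ (≈-sym (id₁⊕-⨾ t u))) (⊕-mono ≤-refl tu≤id)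

join-split : (x : Fin n) → join x ⨾ split x ≤ idn (suc n)
join-split {suc n} zero = ≤-trans (≤-≈ (≈-sym (⊕-⨾ˡ μ δ)))
  (≤-trans (⊕-mono ax₄ ≤-refl) (≤-≈ (⊕-id 2 n)))
join-split {suc n} (suc x) = ≤-trans (cancel (id₁ ⊕ join x) (id₁ ⊕ split x) (id₁⊕-≤-idn (join x) (split x) (join-split x)))
  (≤-≈ (≈-trans (⨾-cong ≈-refl (≈-sym (⨾-idʳ _))) (≋⇒≈ (σ-inverse n))))

-- `func f` is built from units and joins: `ax₂` removes the closed wire that a unit leaves, and
-- `ax₄` the merging followed by a branching that a join leaves.
func-counit : (f : Fin n → Fin m) → func f ⨾ op (func f) ≤ idn n
func-counit {zero} {m} f = ηs-counit m
func-counit {suc n} f = ≤-trans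
  (cancel (join (f zero)) _ (≤-trans (≤-≈ (⨾-cong ≈-refl (≈-reflexive (op-join (f zero))))) (join-split (f zero))))
  (id₁⊕-≤-idn _ _ (func-counit (f ∘ suc)))

nf-mono : {c d : Cospan n m} → c ⊑ d → nf c ≤ nf d
nf-mono {c = c} {d} (g , gˡ , gʳ) = ≤-trans (≤-≈ (⨾-cong factorˡ (op-resp-≈ factorʳ))) (cancel (func g) _ (func-counit g))
  where
  factorˡ : func (left c) ≈ func (left d) ⨾ func g
  factorˡ = ≈-trans (func-cong (sym ∘ gˡ)) (≈-sym (unsingle (≋-trans (≋-sym (compose _ _)) (func-∘ (left d) g))))
  factorʳ : func (right c) ≈ func (right d) ⨾ func g
  factorʳ = ≈-trans (func-cong (sym ∘ gʳ)) (≈-sym (unsingle (≋-trans (≋-sym (compose _ _)) (func-∘ (right d) g))))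

-- Evaluation of terms

F : Term n m → Cospan n m
F δ = δC
F ε = εC
F μ = μC
F η = ηC
F id₀ = idC 0
F id₁ = idC 1
F σ = σC
F (t ⨾ u) = F t ⨾C F u
F (t ⊕ u) = F t ⊕C F u

nf-graph : (f : Fin n → Fin m) → nf (graph f) ≈ func f
nf-graph {m = m} f = ≈-trans (⨾-cong ≈-refl op-func-id) (⨾-idʳ _)
  where
  op-func-id : op (func id) ≈ idn m
  op-func-id = ≈-trans (op-resp-≈ (func-id m)) (≈-reflexive (op-idn m))

nf-cograph : (f : Fin n → Fin m) → nf (cograph f) ≈ op (func f)
nf-cograph {m = m} f = ≈-trans (⨾-cong (func-id m) ≈-refl) (⨾-idˡ _)

nf-F : (t : Term n m) → nf (F t) ≈ t
nf-F δ = ≈-trans (nf-cograph (left μC)) (op-resp-≈ func-const)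
nf-F ε = ≈-trans (nf-cograph (left ηC)) (op-resp-≈ (⊕-unitʳ η))
nf-F μ = ≈-trans (nf-graph (left μC)) func-const
nf-F η = ≈-trans (nf-graph (left ηC)) (⊕-unitʳ η)
nf-F id₀ = ≈-trans (nf-graph id) (func-id 0)
nf-F id₁ = ≈-trans (nf-graph id) (≈-trans (func-id 1) ⊕-id-id₁)
nf-F σ = ≈-trans (nf-cograph swap₂) (op-resp-≈ func-swap)
nf-F (t ⨾ u) = ≈-trans (≈-sym (nf-⨾ (F t) (F u))) (⨾-cong (nf-F t) (nf-F u))
nf-F (t ⊕ u) = ≈-trans (≈-sym (nf-⊕ (F t) (F u))) (⊕-cong (nf-F t) (nf-F u))

-- Universal property of the pushout

merge-identifies : (u v : Fin n) → merge u v u ≡ merge u v v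
merge-identifies zero zero = refl
merge-identifies zero (suc v) = refl
merge-identifies (suc u) zero = refl
merge-identifies (suc u) (suc v) = cong suc (merge-identifies u v)

-- A section of `merge u v`. A map that agrees on `u` and `v` descends to the quotient by
-- precomposition with it, which is how `mediate` is built.
choose : (u v : Fin n) → Fin (merged u v) → Fin n
choose zero zero = id
choose zero (suc v) = suc
choose (suc u) zero = suc
choose (suc u) (suc v) = liftF 1 (choose u v)

merge-choose : (u v : Fin n) (w : Fin (merged u v)) → merge u v (choose u v w) ≡ w
merge-choose zero zero w = refl
merge-choose zero (suc v) w = refl
merge-choose (suc u) zero w = refl
merge-choose (suc u) (suc v) zero = refl
merge-choose (suc u) (suc v) (suc w) = cong suc (merge-choose u v w)

choose-merge : {X : Set} (h : Fin n → X) (u v : Fin n) → h u ≡ h v → ∀ w → h (choose u v (merge u v w)) ≡ h w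
choose-merge h zero zero hu≡hv w = refl
choose-merge h zero (suc v) hu≡hv zero = sym hu≡hv
choose-merge h zero (suc v) hu≡hv (suc w) = refl
choose-merge h (suc u) zero hu≡hv zero = hu≡hv
choose-merge h (suc u) zero hu≡hv (suc w) = refl
choose-merge h (suc u) (suc v) hu≡hv zero = refl
choose-merge h (suc u) (suc v) hu≡hv (suc w) = choose-merge (h ∘ suc) u v hu≡hv w

pushout-square : (f : Fin z → Fin a) (g : Fin z → Fin b) → left (pushout f g) ∘ f ≗ right (pushout f g) ∘ g
pushout-square {suc z} f g zero = merge-identifies (left P (f zero)) (right P (g zero))
  where P = pushout (f ∘ suc) (g ∘ suc)
pushout-square {suc z} f g (suc k) = cong (merge (left P (f zero)) (right P (g zero))) (pushout-square (f ∘ suc) (g ∘ suc) k)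
  where P = pushout (f ∘ suc) (g ∘ suc)

-- Joint surjectivity of the legs, which yields the uniqueness half of the universal property.
Covered : Cospan a b → Set
Covered c = ∀ w → (∃ λ x → left c x ≡ w) ⊎ (∃ λ y → right c y ≡ w)

pushout-covered : (f : Fin z → Fin a) (g : Fin z → Fin b) → Covered (pushout f g)
pushout-covered {zero} {a} {b} f g w with splitAt a w | join-splitAt a b w
... | inj₁ x | eq = inj₁ (x , eq)
... | inj₂ y | eq = inj₂ (y , eq)
pushout-covered {suc z} f g w = Sum.map lift-image lift-image (pushout-covered (f ∘ suc) (g ∘ suc) (choose u v w))
  where
  P = pushout (f ∘ suc) (g ∘ suc)
  u = left P (f zero)
  v = right P (g zero)
  lift-image : ∀ {c} {h : Fin c → Fin (apex P)} → (∃ λ x → h x ≡ choose u v w) → ∃ λ x → merge u v (h x) ≡ w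
  lift-image (x , eq) = x , trans (cong (merge u v) eq) (merge-choose u v w)

module _ {X : Set} {a b : ℕ} (h : Fin a → X) (k : Fin b → X) where

  mediate : (f : Fin z → Fin a) (g : Fin z → Fin b) → Fin (apex (pushout f g)) → X
  mediate {zero} f g = [ h , k ] ∘ splitAt a
  mediate {suc z} f g = mediate (f ∘ suc) (g ∘ suc) ∘ choose (left P (f zero)) (right P (g zero))
    where P = pushout (f ∘ suc) (g ∘ suc)

  mediate-left : (f : Fin z → Fin a) (g : Fin z → Fin b) → h ∘ f ≗ k ∘ g →
                 mediate f g ∘ left (pushout f g) ≗ h
  mediate-right : (f : Fin z → Fin a) (g : Fin z → Fin b) → h ∘ f ≗ k ∘ g →
                  mediate f g ∘ right (pushout f g) ≗ k
  mediate-merges : (f : Fin (suc z) → Fin a) (g : Fin (suc z) → Fin b) → h ∘ f ≗ k ∘ g →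
                   let P = pushout (f ∘ suc) (g ∘ suc); e = mediate (f ∘ suc) (g ∘ suc) in
                   e (left P (f zero)) ≡ e (right P (g zero))

  mediate-left {zero} f g hf≗kg x = cong [ h , k ] (splitAt-↑ˡ a x b)
  mediate-left {suc z} f g hf≗kg x = trans
    (choose-merge (mediate (f ∘ suc) (g ∘ suc)) (left P (f zero)) (right P (g zero)) (mediate-merges f g hf≗kg) _)
    (mediate-left (f ∘ suc) (g ∘ suc) (hf≗kg ∘ suc) x)
    where P = pushout (f ∘ suc) (g ∘ suc)

  mediate-right {zero} f g hf≗kg y = cong [ h , k ] (splitAt-↑ʳ a b y)
  mediate-right {suc z} f g hf≗kg y = trans
    (choose-merge (mediate (f ∘ suc) (g ∘ suc)) (left P (f zero)) (right P (g zero)) (mediate-merges f g hf≗kg) _)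
    (mediate-right (f ∘ suc) (g ∘ suc) (hf≗kg ∘ suc) y)
    where P = pushout (f ∘ suc) (g ∘ suc)

  mediate-merges f g hf≗kg = trans (mediate-left (f ∘ suc) (g ∘ suc) (hf≗kg ∘ suc) (f zero))
    (trans (hf≗kg zero) (sym (mediate-right (f ∘ suc) (g ∘ suc) (hf≗kg ∘ suc) (g zero))))

⨾C-isComposite : (c : Cospan n z) (d : Cospan z m) → IsComposite c d (c ⨾C d)
⨾C-isComposite c d = record
  { inl = left P
  ; inr = right P
  ; square = pushout-square f g
  ; legˡ = λ i → refl
  ; legʳ = λ j → refl
  ; universal = λ q h k hf≗kg → mediate h k f g , mediate-left h k f g hf≗kg , mediate-right h k f g hf≗kg ,
      λ h′ h′l h′r w → unique h′ (mediate h k f g)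
        (λ x → trans (h′l x) (sym (mediate-left h k f g hf≗kg x)))
        (λ y → trans (h′r y) (sym (mediate-right h k f g hf≗kg y))) (pushout-covered f g w)
  }
  where
  f = right c
  g = left d
  P = pushout f g
  unique : ∀ {q} (h h′ : Fin (apex P) → Fin q) → h ∘ left P ≗ h′ ∘ left P → h ∘ right P ≗ h′ ∘ right P →
           ∀ {w} → (∃ λ x → left P x ≡ w) ⊎ (∃ λ y → right P y ≡ w) → h w ≡ h′ w
  unique h h′ l r (inj₁ (x , refl)) = l x
  unique h h′ l r (inj₂ (y , refl)) = r y

-- Cospans representing terms, functions and normal forms

represents-F : (t : Term n m) → Represents t (F t)
represents-F δ = represents-spider spider-δ _ _
represents-F ε = represents-spider spider-ε _ _
represents-F μ = represents-spider spider-μ _ _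
represents-F η = represents-spider spider-η _ _
represents-F id₀ = represents-id₀
represents-F id₁ = represents-spider spider-id₁ _ _
represents-F σ = represents-σ
represents-F (t ⨾ u) = represents-⨾ (represents-F t) (represents-F u) (⨾C-isComposite (F t) (F u))
represents-F (t ⊕ u) = represents-⊕ (represents-F t) (represents-F u)

-- Leads to `represents-nf`, and so to surjectivity, without evaluating the pushouts in `F (nf c)`.
-- The reversed term is tracked as well because the right leg enters a normal form through `op`.
record Realizes (t : Term n m) (f : Fin n → Fin m) : Set where
  constructor realizes
  field
    represents-graph   : Represents t (graph f)
    represents-cograph : Represents (op t) (cograph f)
open Realizes

realizes-resp : {t : Term n m} {f g : Fin n → Fin m} → f ≗ g → Realizes t f → Realizes t g
realizes-resp f≗g (realizes R R′) =
  realizes (represents-resp R f≗g (λ _ → refl)) (represents-resp R′ (λ _ → refl) f≗g)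

graph-isComposite : (f : Fin n → Fin m) (g : Fin m → Fin p) → IsComposite (graph f) (graph g) (graph (g ∘ f))
graph-isComposite f g = record
  { inl = g ; inr = id ; square = λ _ → refl ; legˡ = λ _ → refl ; legʳ = λ _ → refl
  ; universal = λ q a b a≗bg → b , sym ∘ a≗bg , (λ _ → refl) , λ h _ hr → hr }

cograph-isComposite : (f : Fin n → Fin m) (g : Fin m → Fin p) → IsComposite (cograph g) (cograph f) (cograph (g ∘ f))
cograph-isComposite f g = record
  { inl = id ; inr = g ; square = λ _ → refl ; legˡ = λ _ → refl ; legʳ = λ _ → refl
  ; universal = λ q a b ag≗b → a , (λ _ → refl) , ag≗b , λ h hl _ → hl }

graph-cograph-isComposite : (c : Cospan n m) → IsComposite (graph (left c)) (cograph (right c)) c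
graph-cograph-isComposite c = record
  { inl = id ; inr = id ; square = λ _ → refl ; legˡ = λ _ → refl ; legʳ = λ _ → refl
  ; universal = λ q a b a≗b → a , (λ _ → refl) , a≗b , λ h hl _ → hl }

realizes-⨾ : {t : Term n m} {u : Term m p} {f : Fin n → Fin m} {g : Fin m → Fin p} →
             Realizes t f → Realizes u g → Realizes (t ⨾ u) (g ∘ f)
realizes-⨾ {f = f} {g} (realizes R R′) (realizes S S′) =
  realizes (represents-⨾ R S (graph-isComposite f g)) (represents-⨾ S′ R′ (cograph-isComposite f g))

realizes-⊕ : {t : Term n m} {u : Term p q} {f : Fin n → Fin m} {g : Fin p → Fin q} →
             Realizes t f → Realizes u g → Realizes (t ⊕ u) (f +F g)
realizes-⊕ {m = m} {q = q} (realizes R R′) (realizes S S′) =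
  -- `id +F id` is the identity only pointwise, so the identity leg has to be replaced.
  realizes (represents-resp (represents-⊕ R S) (λ _ → refl) (join-splitAt m q))
           (represents-resp (represents-⊕ R′ S′) (join-splitAt m q) (λ _ → refl))

realizes-μ : Realizes μ (const zero)
realizes-μ = realizes (represents-spider spider-μ _ _) (represents-spider spider-δ _ _)

realizes-η : Realizes η (λ ())
realizes-η = realizes (represents-spider spider-η _ _) (represents-spider spider-ε _ _)

realizes-id₁ : Realizes id₁ id
realizes-id₁ = realizes (represents-spider spider-id₁ _ _) (represents-spider spider-id₁ _ _)

realizes-σ : Realizes σ swap₂
realizes-σ = realizes represents-σ′ represents-σ

realizes-idn : ∀ n → Realizes (idn n) id
realizes-idn zero = realizes represents-id₀ represents-id₀
realizes-idn (suc n) = realizes-resp (join-splitAt 1 n) (realizes-⊕ realizes-id₁ (realizes-idn n))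

realizes-join : (x : Fin n) → Realizes (join x) (collapse x)
realizes-join {suc n} zero = realizes-resp (λ { zero → refl ; (suc zero) → refl ; (suc (suc w)) → refl })
  (realizes-⊕ realizes-μ (realizes-idn n))
realizes-join {suc n} (suc x) = realizes-resp (λ { zero → refl ; (suc zero) → refl ; (suc (suc w)) → refl })
  (realizes-⨾ (realizes-⊕ realizes-σ (realizes-idn n)) (realizes-⊕ realizes-id₁ (realizes-join x)))

realizes-ηs : ∀ n → Realizes (ηs n) (λ ())
realizes-ηs zero = realizes-resp (λ ()) (realizes-idn 0)
realizes-ηs (suc n) = realizes-resp (λ ()) (realizes-⊕ realizes-η (realizes-ηs n))

realizes-func : (f : Fin n → Fin m) → Realizes (func f) f
realizes-func {zero} f = realizes-resp (λ ()) (realizes-ηs _)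
realizes-func {suc n} f = realizes-resp (λ { zero → refl ; (suc i) → refl })
  (realizes-⨾ (realizes-⊕ realizes-id₁ (realizes-func (f ∘ suc))) (realizes-join (f zero)))

represents-nf : (c : Cospan n m) → Represents (nf c) c
represents-nf c = represents-⨾ (represents-graph (realizes-func (left c)))
  (represents-cograph (realizes-func (right c))) (graph-cograph-isComposite c)

≅-refl : {c : Cospan n m} → c ≅ c
≅-refl = record { iso = ↔-id _ ; commˡ = λ _ → refl ; commʳ = λ _ → refl }

mainTheorem4 : Σ (∀ {n m : ℕ} → Term n m → Cospan n m) IsCBIso
mainTheorem4 = F , record
  { F-resp-≈ = λ {_} {_} {t} {u} t≈u → ≃⇒≅ (represents-F t) (represents-F u) (≈⇒≃ t≈u)
  ; F-mono   = λ {_} {_} {t} {u} t≤u → ⇛⇒⊑ (represents-F t) (represents-F u) (≤⇒⇛ t≤u)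
  ; F-⨾      = λ t u → ⨾C-isComposite (F t) (F u)
  ; F-⊕      = λ t u → ≅-refl
  ; F-id₀    = ≅-refl
  ; F-id₁    = ≅-refl
  ; F-σ      = ≅-refl
  ; F-μ      = ≅-refl
  ; F-η      = ≅-refl
  ; F-δ      = ≅-refl
  ; F-ε      = ≅-refl
  ; F-inj    = λ {_} {_} {t} {u} Ft≅Fu → ≈-trans (≈-sym (nf-F t)) (≈-trans (nf-cong Ft≅Fu) (nf-F u))
  -- Both cospans represent the one term `nf c`, so the identity on its colourings gives the
  -- isomorphism.
  ; F-surj   = λ c → nf c , ≃⇒≅ (represents-F (nf c)) (represents-nf c) ≃-refl
  ; F-refl   = λ {_} {_} {t} {u} Ft⊑Fu →
      ≤-trans (≤-≈ (≈-sym (nf-F t))) (≤-trans (nf-mono Ft⊑Fu) (≤-≈ (nf-F u)))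
  }
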